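{- Let $q$ be a prime power, let $E_1=\mathbb{F}_q^{n_1}$ and $E_2=\mathbb{F}_q^{n_2}$, and let $M_1=(E_1,\rho_1)$ and $M_2=(E_2,\rho_2)$ be transversal $q$-matroids with respective presentations $\mathcal{X}_1=(A_1,\dots,A_k)$ and $\mathcal{X}_2=(B_1,\dots,B_\ell)$. If $M_1$ and $M_2$ are coordinate $q$-matroids, then the direct sum $M_1\oplus M_2$ is a coordinate transversal $q$-matroid with presentation $$\mathcal{X}_1\oplus\mathcal{X}_2=(A_1\oplus E_2,\dots,A_k\oplus E_2,\;E_1\oplus B_1,\dots,E_1\oplus B_\ell).$$
   Context: A $q$-matroid $M=(E,\rho)$ consists of a finite-dimensional vector space $E$ over a finite field $\mathbb{F}_q$ and a function $\rho$ from the set of subspaces of $E$ to $\mathbb{Z}_{\ge 0}$ such that for all $X,Y\le E$: $0\le\rho(X)\le\dim X$; $X\le Y$ implies $\rho(X)\le\rho(Y)$; and $\rho(X+Y)+\rho(X\cap Y)\le\rho(X)+\rho(Y)$. A subspace $X$ is independent if $\rho(X)=\dim X$; it is a flat if $\rho(X)<\rho(X\oplus\langle v\rangle)$ for all $v\in E\setminus X$; it is cyclic if $\rho(H)=\rho(X)$ for every subspace $H\le X$ with $\dim H=\dim X-1$; it is a cyclic flat if it is both. A subspace of $\mathbb{F}_q^n$ is coordinate if it is spanned by a subset of the standard basis vectors. A coordinate $q$-matroid is a $q$-matroid on $\mathbb{F}_q^n$ all of whose cyclic flats are coordinate subspaces. Given a finite family (repetitions allowed) $\mathcal{A}$ of $k$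 subsets of a set, a finite set $X$ has an avoidance transversal of $\mathcal{A}$ if there are orderings $X=\{x_1,\dots,x_\ell\}$ and $\mathcal{A}=(A_1,\dots,A_k)$, with $\ell\le k$, such that $x_i\notin A_i$ for each $i\in[\ell]$. For a finite family $\mathcal{X}$ of subspaces of $E$, a subspace $X\le E$ is a partial $q$-transversal of $\mathcal{X}$ if every linear basis of $X$ has an avoidance transversal of $\mathcal{X}$. The transversal $q$-matroid on $E$ with presentation $\mathcal{X}$ is the $q$-matroid whose independent spaces are exactly the partial $q$-transversals of $\mathcal{X}$. For vector spaces $E_1,E_2$ over the same field, $\pi_i$ denotes the projection $E_1\oplus E_2\to E_i$, and for $X_i\le E_i$, $X_1\oplus X_2$ denotes the corresponding subspace of $E_1\oplus E_2$; $\mathbb{F}_q^{n_1}\oplus\mathbb{F}_q^{n_2}$ is identified with $\mathbb{F}_q^{n_1+n_2}$ by concatenating coordinates. The direct sum of $q$-matroids $M_1=(E_1,\rho_1)$ and $M_2=(E_2,\rho_2)$ is the $q$-matroid $M_1\oplus M_2=(E_1\oplus E_2,\rho)$ with $$\rho(X)=\min\{\rho_1(\pi_1(Y))+\rho_2(\pi_2(Y))+\dim(X)-\dim(Y):Y\le X\}.$$ -}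

module Defs where

open import Algebra.Bundles using (CommutativeRing)
import Algebra.Properties.CommutativeSemigroup as CommutativeSemigroupProperties
import Algebra.Properties.Ring as RingProperties
open import Algebra.Structures using (IsCommutativeRing)
open import Data.Fin.Base using (Fin; inject≤)
open import Data.Fin.Permutation using (Permutation′; _⟨$⟩ʳ_)
import Data.Fin.Properties as Fin
open import Data.Fin.Subset using (Subset)
import Data.Fin.Subset.Properties as Subset
open import Data.List.Base as List using (List; []; _∷_)
open import Data.List.Extrema.Nat using (min)
open import Data.List.Membership.Propositional as List using (lose)
import Data.List.Membership.Propositional.Properties as List
open import Data.List.Relation.Unary.All as All using (All; []; _∷_)
import Data.List.Relation.Unary.All.Properties as All
open import Data.List.Relation.Unary.Any as Any using (Any; here; there)
open import Data.Nat.Base using (ℕ; zero; suc; _+_; _∸_; _^_; _≤_; _<_)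
open import Data.Nat.Primality using (Prime)
open import Data.Product.Base using (Σ; ∃; ∃₂; _×_; _,_; proj₁; proj₂)
open import Data.Unit.Base using (⊤; tt)
open import Data.Vec.Base as Vec
  using (Vec; []; _∷_; lookup; map; replicate; zipWith; take; drop; _++_; _[_]≔_)
open import Data.Vec.Properties
  using (≡-dec; take-zipWith; take-map; drop-zipWith; drop-map)
open import Function.Base using (_∘_)
open import Function.Bundles using (_↔_; _⇔_; Inverse)
open import Level using (0ℓ)
open import Relation.Binary.Definitions using (DecidableEquality)
open import Relation.Binary.PropositionalEquality
open import Relation.Nullary using (Dec; yes; no; ¬_; contradiction)
open import Relation.Nullary.Decidable using (map′; _×-dec_)
open import Relation.Unary using (Pred; Decidable)

IsPrimePower : ℕ → Set
IsPrimePower q = ∃₂ λ p m → Prime p × 1 ≤ m × q ≡ p ^ m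

record FiniteField (q : ℕ) : Set₁ where
  infixl 7 _*ᶠ_
  infixl 6 _+ᶠ_
  infix  8 -ᶠ_
  field
    Carrier           : Set
    _+ᶠ_ _*ᶠ_         : Carrier → Carrier → Carrier
    -ᶠ_               : Carrier → Carrier
    0# 1#             : Carrier
    isCommutativeRing : IsCommutativeRing _≡_ _+ᶠ_ _*ᶠ_ -ᶠ_ 0# 1#
    0≢1               : 0# ≢ 1#
    inverse           : ∀ x → x ≢ 0# → ∃ λ y → x *ᶠ y ≡ 1#
    finite            : Carrier ↔ Fin q

-- A family of k subsets of A, and a set with l distinct elements listed as xs
-- (the lists used below are bases, hence have no repetitions).  The
-- permutations σ and τ are the two reorderings.
HasAvoidanceTransversal : {A : Set} {k l : ℕ} → (Fin k → Pred A 0ℓ) → Vec A l → Set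
HasAvoidanceTransversal {k = k} {l} 𝒜 xs =
  Σ (l ≤ k) λ l≤k → ∃₂ λ (σ : Permutation′ l) (τ : Permutation′ k) →
    ∀ i → ¬ 𝒜 (τ ⟨$⟩ʳ inject≤ i l≤k) (lookup xs (σ ⟨$⟩ʳ i))

sublists : {A : Set} → List A → List (List A)
sublists []       = [] ∷ []
sublists (x ∷ xs) = List.map (x ∷_) (sublists xs) List.++ sublists xs

filter∈sublists : {A : Set} {P : Pred A 0ℓ} (P? : Decidable P) (xs : List A) →
                  List.filter P? xs List.∈ sublists xs
filter∈sublists P? []       = here refl
filter∈sublists P? (x ∷ xs) with P? x
... | yes _ = List.∈-++⁺ˡ (List.∈-map⁺ (x ∷_) (filter∈sublists P? xs))
... | no  _ = List.∈-++⁺ʳ (List.map (x ∷_) (sublists xs)) (filter∈sublists P? xs)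

sublists-All : {A : Set} {P : Pred A 0ℓ} {xs : List A} →
               All P xs → All (All P) (sublists xs)
sublists-All []         = [] ∷ []
sublists-All (px ∷ pxs) =
  All.++⁺ (All.map⁺ (All.map (px ∷_) (sublists-All pxs))) (sublists-All pxs)

module QMatroids {q : ℕ} (F : FiniteField q) where

  open FiniteField F

  private
    R : CommutativeRing 0ℓ 0ℓ
    R = record { isCommutativeRing = isCommutativeRing }

    module R where
      open CommutativeRing R public
      open RingProperties ring public
      open CommutativeSemigroupProperties
        (CommutativeRing.+-commutativeSemigroup R) public using (interchange)

  _≟ᶠ_ : DecidableEquality Carrier
  x ≟ᶠ y = map′ (λ eq → trans (sym (strictlyInverseʳ x))
                          (trans (cong from eq) (strictlyInverseʳ y)))
                (cong to) (to x Fin.≟ to y)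
    where open Inverse finite

  Vector : ℕ → Set
  Vector = Vec Carrier

  infixl 6 _+ᵛ_
  infixr 7 _·_

  0ᵛ : ∀ {n} → Vector n
  0ᵛ = replicate _ 0#

  _+ᵛ_ : ∀ {n} → Vector n → Vector n → Vector n
  _+ᵛ_ = zipWith _+ᶠ_

  _·_ : ∀ {n} → Carrier → Vector n → Vector n
  c · v = map (c *ᶠ_) v

  unit : ∀ {n} → Fin n → Vector n
  unit i = 0ᵛ [ i ]≔ 1#

  lincomb : ∀ {n k} → Vec Carrier k → Vec (Vector n) k → Vector n
  lincomb []       []       = 0ᵛ
  lincomb (c ∷ cs) (v ∷ vs) = c · v +ᵛ lincomb cs vs

  +ᵛ-identityˡ : ∀ {n} (v : Vector n) → 0ᵛ +ᵛ v ≡ v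
  +ᵛ-identityˡ []      = refl
  +ᵛ-identityˡ (x ∷ v) = cong₂ _∷_ (R.+-identityˡ x) (+ᵛ-identityˡ v)

  +ᵛ-identityʳ : ∀ {n} (v : Vector n) → v +ᵛ 0ᵛ ≡ v
  +ᵛ-identityʳ []      = refl
  +ᵛ-identityʳ (x ∷ v) = cong₂ _∷_ (R.+-identityʳ x) (+ᵛ-identityʳ v)

  +ᵛ-interchange : ∀ {n} (u v w x : Vector n) →
                   (u +ᵛ v) +ᵛ (w +ᵛ x) ≡ (u +ᵛ w) +ᵛ (v +ᵛ x)
  +ᵛ-interchange []      []      []      []      = refl
  +ᵛ-interchange (a ∷ u) (b ∷ v) (c ∷ w) (d ∷ x) =
    cong₂ _∷_ (R.interchange a b c d) (+ᵛ-interchange u v w x)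

  ·-distribˡ : ∀ {n} c (v w : Vector n) → c · (v +ᵛ w) ≡ c · v +ᵛ c · w
  ·-distribˡ c []      []      = refl
  ·-distribˡ c (x ∷ v) (y ∷ w) = cong₂ _∷_ (R.distribˡ c x y) (·-distribˡ c v w)

  ·-distribʳ : ∀ {n} (v : Vector n) c d → (c +ᶠ d) · v ≡ c · v +ᵛ d · v
  ·-distribʳ []      c d = refl
  ·-distribʳ (x ∷ v) c d = cong₂ _∷_ (R.distribʳ x c d) (·-distribʳ v c d)

  ·-assoc : ∀ {n} c d (v : Vector n) → (c *ᶠ d) · v ≡ c · d · v
  ·-assoc c d []      = refl
  ·-assoc c d (x ∷ v) = cong₂ _∷_ (R.*-assoc c d x) (·-assoc c d v)

  ·-identityˡ : ∀ {n} (v : Vector n) → 1# · v ≡ v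
  ·-identityˡ []      = refl
  ·-identityˡ (x ∷ v) = cong₂ _∷_ (R.*-identityˡ x) (·-identityˡ v)

  ·-zeroˡ : ∀ {n} (v : Vector n) → 0# · v ≡ 0ᵛ
  ·-zeroˡ []      = refl
  ·-zeroˡ (x ∷ v) = cong₂ _∷_ (R.zeroˡ x) (·-zeroˡ v)

  ·-zeroʳ : ∀ {n} c → c · 0ᵛ {n} ≡ 0ᵛ
  ·-zeroʳ {zero}  c = refl
  ·-zeroʳ {suc n} c = cong₂ _∷_ (R.zeroʳ c) (·-zeroʳ c)

  lincomb-0 : ∀ {n k} (vs : Vec (Vector n) k) → lincomb 0ᵛ vs ≡ 0ᵛ
  lincomb-0 []       = refl
  lincomb-0 (v ∷ vs) = trans (cong₂ _+ᵛ_ (·-zeroˡ v) (lincomb-0 vs)) (+ᵛ-identityˡ 0ᵛ)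

  lincomb-+ : ∀ {n k} (cs ds : Vec Carrier k) (vs : Vec (Vector n) k) →
              lincomb (cs +ᵛ ds) vs ≡ lincomb cs vs +ᵛ lincomb ds vs
  lincomb-+ []       []       []       = sym (+ᵛ-identityˡ 0ᵛ)
  lincomb-+ (c ∷ cs) (d ∷ ds) (v ∷ vs) =
    trans (cong₂ _+ᵛ_ (·-distribʳ v c d) (lincomb-+ cs ds vs))
          (+ᵛ-interchange (c · v) (d · v) (lincomb cs vs) (lincomb ds vs))

  lincomb-· : ∀ {n k} a (cs : Vec Carrier k) (vs : Vec (Vector n) k) →
              lincomb (a · cs) vs ≡ a · lincomb cs vs
  lincomb-· a []       []       = sym (·-zeroʳ a)
  lincomb-· a (c ∷ cs) (v ∷ vs) =
    trans (cong₂ _+ᵛ_ (·-assoc a c v) (lincomb-· a cs vs))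
          (sym (·-distribˡ a (c · v) (lincomb cs vs)))

  scalars : List Carrier
  scalars = List.map (Inverse.from finite) (List.allFin q)

  ∈-scalars : ∀ x → x List.∈ scalars
  ∈-scalars x =
    subst (List._∈ scalars) (strictlyInverseʳ x) (List.∈-map⁺ from (List.∈-allFin (to x)))
    where open Inverse finite

  vectors : ∀ n → List (Vector n)
  vectors zero    = [] ∷ []
  vectors (suc n) = List.cartesianProductWith _∷_ scalars (vectors n)

  ∈-vectors : ∀ {n} (v : Vector n) → v List.∈ vectors n
  ∈-vectors []      = here refl
  ∈-vectors (x ∷ v) = List.∈-cartesianProductWith⁺ _∷_ (∈-scalars x) (∈-vectors v)

  ∃? : ∀ {n} {P : Pred (Vector n) 0ℓ} → Decidable P → Dec (∃ P)
  ∃? P? = map′ Any.satisfied (λ (v , Pv) → lose (∈-vectors v) Pv) (Any.any? P? (vectors _))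

  -- Classically every subset of the finite set 𝔽_q^n is decidable, so asking
  -- for decidability excludes no subspace.
  record Subspace (n : ℕ) : Set₁ where
    field
      Member   : Pred (Vector n) 0ℓ
      member?  : Decidable Member
      0-closed : Member 0ᵛ
      +-closed : ∀ {v w} → Member v → Member w → Member (v +ᵛ w)
      ·-closed : ∀ c {v} → Member v → Member (c · v)
  open Subspace public

  infix 4 _∈_ _∉_ _⊑_ _≐_

  _∈_ _∉_ : ∀ {n} → Vector n → Subspace n → Set
  v ∈ X = Member X v
  v ∉ X = ¬ (v ∈ X)

  _⊑_ _≐_ : ∀ {n} → Subspace n → Subspace n → Set
  X ⊑ Y = ∀ v → v ∈ X → v ∈ Y
  X ≐ Y = X ⊑ Y × Y ⊑ X

  full : ∀ {n} → Subspace n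
  full = record
    { Member   = λ _ → ⊤
    ; member?  = λ _ → yes tt
    ; 0-closed = tt
    ; +-closed = λ _ _ → tt
    ; ·-closed = λ _ _ → tt
    }

  span : ∀ {n k} → Vec (Vector n) k → Subspace n
  span vs = record
    { Member   = λ v → ∃ λ cs → lincomb cs vs ≡ v
    ; member?  = λ v → ∃? λ cs → ≡-dec _≟ᶠ_ (lincomb cs vs) v
    ; 0-closed = 0ᵛ , lincomb-0 vs
    ; +-closed = λ { (cs , refl) (ds , refl) → cs +ᵛ ds , lincomb-+ cs ds vs }
    ; ·-closed = λ { a (cs , refl) → a · cs , lincomb-· a cs vs }
    }

  infixl 6 _+ˢ_
  infixl 7 _∩_

  _+ˢ_ : ∀ {n} → Subspace n → Subspace n → Subspace n
  X +ˢ Y = record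
    { Member   = λ v → ∃ λ x → ∃ λ y → x ∈ X × y ∈ Y × x +ᵛ y ≡ v
    ; member?  = λ v → ∃? λ x → ∃? λ y →
                   member? X x ×-dec member? Y y ×-dec ≡-dec _≟ᶠ_ (x +ᵛ y) v
    ; 0-closed = 0ᵛ , 0ᵛ , 0-closed X , 0-closed Y , +ᵛ-identityˡ 0ᵛ
    ; +-closed = λ { (x , y , x∈ , y∈ , refl) (x′ , y′ , x′∈ , y′∈ , refl) →
                   x +ᵛ x′ , y +ᵛ y′ , +-closed X x∈ x′∈ , +-closed Y y∈ y′∈ ,
                   +ᵛ-interchange x x′ y y′ }
    ; ·-closed = λ { c (x , y , x∈ , y∈ , refl) →
                   c · x , c · y , ·-closed X c x∈ , ·-closed Y c y∈ ,
                   sym (·-distribˡ c x y) }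
    }

  _∩_ : ∀ {n} → Subspace n → Subspace n → Subspace n
  X ∩ Y = record
    { Member   = λ v → v ∈ X × v ∈ Y
    ; member?  = λ v → member? X v ×-dec member? Y v
    ; 0-closed = 0-closed X , 0-closed Y
    ; +-closed = λ (v∈X , v∈Y) (w∈X , w∈Y) → +-closed X v∈X w∈X , +-closed Y v∈Y w∈Y
    ; ·-closed = λ c (v∈X , v∈Y) → ·-closed X c v∈X , ·-closed Y c v∈Y
    }

  image : ∀ {m n} (f : Vector m → Vector n) →
          (∀ v w → f (v +ᵛ w) ≡ f v +ᵛ f w) → (∀ c v → f (c · v) ≡ c · f v) →
          Subspace m → Subspace n
  image f f-+ f-· X = record
    { Member   = λ w → ∃ λ v → v ∈ X × f v ≡ w
    ; member?  = λ w → ∃? λ v → member? X v ×-dec ≡-dec _≟ᶠ_ (f v) w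
    ; 0-closed = 0ᵛ , 0-closed X ,
                 trans (cong f (sym (·-zeroˡ 0ᵛ))) (trans (f-· 0# 0ᵛ) (·-zeroˡ (f 0ᵛ)))
    ; +-closed = λ { (v , v∈ , refl) (w , w∈ , refl) → v +ᵛ w , +-closed X v∈ w∈ , f-+ v w }
    ; ·-closed = λ { c (v , v∈ , refl) → c · v , ·-closed X c v∈ , f-· c v }
    }

  π₁ : ∀ n₁ {n₂} → Subspace (n₁ + n₂) → Subspace n₁
  π₁ n₁ = image (take n₁) (take-zipWith _+ᶠ_) (λ c → take-map (c *ᶠ_) n₁)

  π₂ : ∀ n₁ {n₂} → Subspace (n₁ + n₂) → Subspace n₂
  π₂ n₁ = image (drop n₁) (drop-zipWith _+ᶠ_) (λ c → drop-map (c *ᶠ_) n₁)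

  infixr 5 _⊕_ _⊕ᵖ_ _⊕ʳ_

  _⊕_ : ∀ {n₁ n₂} → Subspace n₁ → Subspace n₂ → Subspace (n₁ + n₂)
  _⊕_ {n₁} X Y = record
    { Member   = λ v → take n₁ v ∈ X × drop n₁ v ∈ Y
    ; member?  = λ v → member? X (take n₁ v) ×-dec member? Y (drop n₁ v)
    ; 0-closed = subst (_∈ X) (sym (take-0 n₁)) (0-closed X) ,
                 subst (_∈ Y) (sym (drop-0 n₁)) (0-closed Y)
    ; +-closed = λ {v} {w} (v₁ , v₂) (w₁ , w₂) →
                   subst (_∈ X) (sym (take-zipWith _+ᶠ_ v w)) (+-closed X v₁ w₁) ,
                   subst (_∈ Y) (sym (drop-zipWith _+ᶠ_ v w)) (+-closed Y v₂ w₂)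
    ; ·-closed = λ c {v} (v₁ , v₂) →
                   subst (_∈ X) (sym (take-map (c *ᶠ_) n₁ v)) (·-closed X c v₁) ,
                   subst (_∈ Y) (sym (drop-map (c *ᶠ_) n₁ v)) (·-closed Y c v₂)
    }
    where
    take-0 : ∀ m {n} → take m (0ᵛ {m + n}) ≡ 0ᵛ
    take-0 zero    = refl
    take-0 (suc m) = cong (0# ∷_) (take-0 m)

    drop-0 : ∀ m {n} → drop m (0ᵛ {m + n}) ≡ 0ᵛ
    drop-0 zero    = refl
    drop-0 (suc m) = drop-0 m

  LinearlyIndependent : ∀ {n k} → Vec (Vector n) k → Set
  LinearlyIndependent vs = ∀ cs → lincomb cs vs ≡ 0ᵛ → cs ≡ 0ᵛ

  IsBasis : ∀ {n k} → Subspace n → Vec (Vector n) k → Set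
  IsBasis X vs = LinearlyIndependent vs × span vs ≐ X

  elements : ∀ {n} → Subspace n → List (Vector n)
  elements X = List.filter (member? X) (vectors _)

  -- Discards every vector that is in the span of the later ones.
  prune : ∀ {n} → List (Vector n) → ∃ (Vec (Vector n))
  prune []       = 0 , []
  prune (v ∷ vs) with prune vs
  ... | k , bs with member? (span bs) v
  ...   | yes _ = k , bs
  ...   | no  _ = suc k , v ∷ bs

  dim : ∀ {n} → Subspace n → ℕ
  dim X = proj₁ (prune (elements X))

  basis : ∀ {n} (X : Subspace n) → Vec (Vector n) (dim X)
  basis X = proj₂ (prune (elements X))

  span-head : ∀ {n k} (v : Vector n) (vs : Vec (Vector n) k) → v ∈ span (v ∷ vs)
  span-head v vs =
    1# ∷ 0ᵛ , trans (cong₂ _+ᵛ_ (·-identityˡ v) (lincomb-0 vs)) (+ᵛ-identityʳ v)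

  span-tail : ∀ {n k} (v : Vector n) (vs : Vec (Vector n) k) → span vs ⊑ span (v ∷ vs)
  span-tail v vs w (cs , refl) =
    0# ∷ cs , trans (cong (_+ᵛ lincomb cs vs) (·-zeroˡ v)) (+ᵛ-identityˡ _)

  LI-∷ : ∀ {n k} {v : Vector n} {vs : Vec (Vector n) k} →
         v ∉ span vs → LinearlyIndependent vs → LinearlyIndependent (v ∷ vs)
  LI-∷ {v = v} {vs} v∉ li (c ∷ cs) eq with c ≟ᶠ 0#
  ... | yes refl = cong (0# ∷_) (li cs
          (trans (sym (trans (cong (_+ᵛ lincomb cs vs) (·-zeroˡ v)) (+ᵛ-identityˡ _))) eq))
  ... | no c≢0 = contradiction (subst (_∈ span vs) d·cv≡v (·-closed (span vs) d cv∈)) v∉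
    where
    d = proj₁ (inverse c c≢0)

    d·cv≡v : d · c · v ≡ v
    d·cv≡v = trans (sym (·-assoc d c v))
      (trans (cong (_· v) (trans (R.*-comm d c) (proj₂ (inverse c c≢0)))) (·-identityˡ v))

    solve-for : ∀ {n} (x y : Vector n) → x +ᵛ y ≡ 0ᵛ → (-ᶠ 1#) · y ≡ x
    solve-for []      []      _  = refl
    solve-for (a ∷ x) (b ∷ y) eq = cong₂ _∷_
      (trans (R.-1*x≈-x b) (sym (R.+-inverseˡ-unique a b (cong Vec.head eq))))
      (solve-for x y (cong Vec.tail eq))

    cv∈ : c · v ∈ span vs
    cv∈ = subst (_∈ span vs) (solve-for (c · v) (lincomb cs vs) eq)
            (·-closed (span vs) (-ᶠ 1#) (cs , refl))

  prune-independent : ∀ {n} (vs : List (Vector n)) → LinearlyIndependent (proj₂ (prune vs))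
  prune-independent []       []  _ = refl
  prune-independent (v ∷ vs) with prune vs | prune-independent vs
  ... | k , bs | li with member? (span bs) v
  ...   | yes _  = li
  ...   | no  v∉ = LI-∷ v∉ li

  prune-spans : ∀ {n} (vs : List (Vector n)) → All (_∈ span (proj₂ (prune vs))) vs
  prune-spans []       = []
  prune-spans (v ∷ vs) with prune vs | prune-spans vs
  ... | k , bs | sp with member? (span bs) v
  ...   | yes v∈ = v∈ ∷ sp
  ...   | no  _  = span-head v bs ∷ All.map (span-tail v bs _) sp

  prune-⊑ : ∀ {n} {X : Subspace n} {vs} → All (_∈ X) vs → span (proj₂ (prune vs)) ⊑ X
  prune-⊑ {X = X} []               _ ([] , refl) = 0-closed X
  prune-⊑ {X = X} {v ∷ vs} (v∈X ∷ vs∈X) w w∈ with prune vs | prune-⊑ {X = X} vs∈X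
  ... | k , bs | ih with member? (span bs) v
  ...   | yes _ = ih w w∈
  ...   | no  _ with w∈
  ...     | c ∷ cs , refl = +-closed X (·-closed X c v∈X) (ih _ (cs , refl))

  basis-isBasis : ∀ {n} (X : Subspace n) → IsBasis X (basis X)
  basis-isBasis X =
    prune-independent (elements X) ,
    prune-⊑ {X = X} (All.all-filter (member? X) (vectors _)) ,
    λ v v∈ → All.lookup (prune-spans (elements X)) (List.∈-filter⁺ (member? X) (∈-vectors v) v∈)

  -- Lists every subspace of X, up to ≐ and possibly repeatedly.
  subspacesOf : ∀ {n} → Subspace n → List (Subspace n)
  subspacesOf X = List.map (span ∘ Vec.fromList) (sublists (elements X))

  span-∋ : ∀ {n} {v : Vector n} {vs} → v List.∈ vs → v ∈ span (Vec.fromList vs)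
  span-∋ {vs = v ∷ vs} (here refl) = span-head v (Vec.fromList vs)
  span-∋ {vs = v ∷ vs} (there v∈)  = span-tail v (Vec.fromList vs) _ (span-∋ v∈)

  span-⊑ : ∀ {n} {X : Subspace n} {vs} → All (_∈ X) vs → span (Vec.fromList vs) ⊑ X
  span-⊑ {X = X} []           _ ([] , refl)     = 0-closed X
  span-⊑ {X = X} (v∈X ∷ vs∈X) _ (c ∷ cs , refl) =
    +-closed X (·-closed X c v∈X) (span-⊑ {X = X} vs∈X _ (cs , refl))

  subspacesOf-sound : ∀ {n} (X : Subspace n) → All (_⊑ X) (subspacesOf X)
  subspacesOf-sound X = All.map⁺ (All.map (span-⊑ {X = X})
    (sublists-All (All.all-filter (member? X) (vectors _))))

  subspacesOf-complete : ∀ {n} (X Y : Subspace n) → Y ⊑ X → Any (_≐ Y) (subspacesOf X)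
  subspacesOf-complete X Y Y⊑X =
    lose (List.∈-map⁺ (span ∘ Vec.fromList) (filter∈sublists (member? Y) (elements X)))
      ( span-⊑ {X = Y} (All.all-filter (member? Y) (elements X))
      , λ v v∈Y → span-∋ (List.∈-filter⁺ (member? Y)
          (List.∈-filter⁺ (member? X) (∈-vectors v) (Y⊑X v v∈Y)) v∈Y) )

  RankFunction : ℕ → Set₁
  RankFunction n = Subspace n → ℕ

  record IsQMatroid {n} (ρ : RankFunction n) : Set₁ where
    field
      bounded    : ∀ X → ρ X ≤ dim X
      monotone   : ∀ X Y → X ⊑ Y → ρ X ≤ ρ Y
      submodular : ∀ X Y → ρ (X +ˢ Y) + ρ (X ∩ Y) ≤ ρ X + ρ Y

  module _ {n} (ρ : RankFunction n) where

    Independent : Subspace n → Set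
    Independent X = ρ X ≡ dim X

    IsFlat : Subspace n → Set
    IsFlat X = ∀ v → v ∉ X → ρ X < ρ (X +ˢ span (v ∷ []))

    IsCyclic : Subspace n → Set₁
    IsCyclic X = ∀ H → H ⊑ X → suc (dim H) ≡ dim X → ρ H ≡ ρ X

    IsCyclicFlat : Subspace n → Set₁
    IsCyclicFlat X = IsCyclic X × IsFlat X

  IsCoordinate : ∀ {n} → Subspace n → Set
  IsCoordinate {n} X = ∃ λ (S : Subset n) →
    X ≐ span (Vec.fromList (List.map unit (List.filter (Subset._∈? S) (List.allFin n))))

  record IsCoordinateQMatroid {n} (ρ : RankFunction n) : Set₁ where
    field
      isQMatroid             : IsQMatroid ρ
      cyclicFlats-coordinate : ∀ X → IsCyclicFlat ρ X → IsCoordinate X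

  IsPartialQTransversal : ∀ {n k} → Vec (Subspace n) k → Subspace n → Set
  IsPartialQTransversal 𝒳 X = ∀ {l} (xs : Vec (Vector _) l) → IsBasis X xs →
    HasAvoidanceTransversal (Member ∘ lookup 𝒳) xs

  record IsTransversalQMatroid {n k} (ρ : RankFunction n) (𝒳 : Vec (Subspace n) k) : Set₁ where
    field
      isQMatroid  : IsQMatroid ρ
      independent : ∀ X → Independent ρ X ⇔ IsPartialQTransversal 𝒳 X

  _⊕ᵖ_ : ∀ {n₁ n₂ k l} → Vec (Subspace n₁) k → Vec (Subspace n₂) l →
         Vec (Subspace (n₁ + n₂)) (k + l)
  𝒳₁ ⊕ᵖ 𝒳₂ = map (_⊕ full) 𝒳₁ ++ map (full ⊕_) 𝒳₂

  -- min ⊤ vs is the least element of ⊤ ∷ vs; here ⊤ is the value at Y = X.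
  -- The truncated subtraction is exact because dim Y ≤ dim X.
  _⊕ʳ_ : ∀ {n₁ n₂} → RankFunction n₁ → RankFunction n₂ → RankFunction (n₁ + n₂)
  _⊕ʳ_ {n₁} ρ₁ ρ₂ X = min (value X) (List.map value (subspacesOf X))
    where
    value : Subspace _ → ℕ
    value Y = ρ₁ (π₁ n₁ Y) + ρ₂ (π₂ n₁ Y) + (dim X ∸ dim Y)

{-# OPTIONS --safe #-}
-- For a monotone submodular f on subspaces with f(0) = 0, the function
-- r_f(X) = min { f(Y) + dim X − dim Y : Y ≤ X } is the rank function of a
-- q-matroid in which X is independent iff dim Y ≤ f(Y) for all Y ≤ X.  By
-- definition, the rank function of M₁ ⊕ M₂ is r_f for f = ρ₁π₁ + ρ₂π₂.
--
-- For f(Y) = #{A ∈ 𝒳 : Y ≰ A}, Hall's theorem says that X is a partial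
-- q-transversal of 𝒳 iff X is independent for r_f, so a transversal q-matroid
-- has rank function r_f.  If f₁ and f₂ are these counts for 𝒳₁ and 𝒳₂, then
-- f₁π₁ + f₂π₂ is the count for 𝒳₁ ⊕ 𝒳₂, and it suffices to see that it defines
-- the same independent spaces as r_{f₁}π₁ + r_{f₂}π₂: if r_{fᵢ}(πᵢY) is attained
-- at Wᵢ ≤ πᵢY, compare with Y ∩ (W₁ ⊕ W₂).
--
-- In a cyclic X the minimum defining r_f(X) is attained only at X.  Hence a
-- cyclic flat X of M₁ ⊕ M₂ has rank ρ₁(π₁X) + ρ₂(π₂X), and flatness gives
-- X = π₁X ⊕ π₂X, where each πᵢX is a cyclic flat of Mᵢ.
module Submission where

open import Algebra.Bundles using (CommutativeRing)
import Algebra.Properties.CommutativeSemigroup as CommutativeSemigroupProperties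
import Algebra.Properties.Ring as RingProperties
open import Data.Bool.Base using (not)
import Data.Bool.Properties as Bool
open import Data.Fin.Base using (Fin; zero; suc; fromℕ<; inject≤; punchIn; splitAt; _↑ˡ_; _↑ʳ_)
open import Data.Fin.Permutation as Perm using (_⟨$⟩ʳ_; _⟨$⟩ˡ_; insert; insert-punchIn; lift₀)
import Data.Fin.Properties as Fin
open import Data.Fin.Subset using (Subset; inside; outside; ∣_∣) renaming (_∈_ to _∈ᵖ_)
import Data.Fin.Subset.Properties as Subset
open import Data.List.Base as List using ([]; _∷_)
open import Data.List.Extrema.Nat using (argmin-all; min; min≤v⁺)
import Data.List.Membership.Propositional.Properties as List
open import Data.List.Relation.Unary.All as All using (All; []; _∷_)
import Data.List.Relation.Unary.All.Properties as All
open import Data.List.Relation.Unary.Any as Any using (any?)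
import Data.List.Relation.Unary.Any.Properties as Any
open import Data.Nat.Base using (ℕ; zero; suc; _+_; _∸_; _^_; _≤_; _<_; s≤s; z≤n)
open import Data.Nat.Properties
open import Data.Product.Base using (Σ; ∃; ∃₂; _×_; _,_; proj₁; proj₂)
open import Data.Product.Function.NonDependent.Propositional using (_×-↔_)
open import Data.Sum.Base using (_⊎_; inj₁; inj₂; fromInj₁; fromInj₂)
open import Data.Vec.Base as Vec
  using (Vec; []; _∷_; drop; insertAt; lookup; removeAt; tabulate; take; _++_)
open import Data.Vec.Properties hiding (insert-punchIn)
open import Function.Base using (id; _∘_)
open import Function.Bundles using (Equivalence; Injection; Inverse; mk⇔; mk↔ₛ′; _⇔_; _↔_)
open import Function.Construct.Composition using (_⇔-∘_; _↔-∘_)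
open import Function.Construct.Symmetry using (⇔-sym)
open import Function.Definitions using (Injective)
open import Function.Properties.Inverse using (↔-sym; ↔⇒↣)
open import Relation.Binary.PropositionalEquality
open import Relation.Nullary using (Dec; contradiction; does; no; yes; ¬_; ¬?; _×-dec_)
open import Relation.Nullary.Decidable using (dec-false; decidable-stable; _→-dec_)

open import Defs

open CommutativeSemigroupProperties +-commutativeSemigroup using (interchange; xy∙z≈xz∙y)

-- Finite sets and vectors with an entry removed

injective⇒≤∣p∣ : ∀ {d k} {p : Subset k} {φ : Fin d → Fin k} →
                 Injective _≡_ _≡_ φ → (∀ j → φ j ∈ᵖ p) → d ≤ ∣ p ∣
injective⇒≤∣p∣ {zero}          _           _   = z≤n
injective⇒≤∣p∣ {suc d} {φ = φ} φ-injective φ∈p = ≤-trans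
  (s≤s (injective⇒≤∣p∣ (Fin.suc-injective ∘ φ-injective)
    λ j → Subset.x∈p∧x≢y⇒x∈p-y (φ∈p (suc j)) (Fin.0≢1+n ∘ sym ∘ φ-injective)))
  (Subset.x∈p⇒∣p-x∣<∣p∣ (φ∈p zero))

-- The hole is at position `l`, just past the range of `inject≤`, so the positions before it do not
-- move.
punchIn-inject≤ : ∀ {l k} (i : Fin l) (l≤k : l ≤ k) →
                  punchIn (fromℕ< (s≤s l≤k)) (inject≤ i l≤k) ≡ inject≤ i (m≤n⇒m≤1+n l≤k)
punchIn-inject≤ zero    (s≤s l≤k) = refl
punchIn-inject≤ (suc i) (s≤s l≤k) = cong suc (punchIn-inject≤ i l≤k)

lookup-removeAt : ∀ {A : Set} {l} (xs : Vec A (suc l)) p j →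
                  lookup (removeAt xs p) j ≡ lookup xs (punchIn p j)
lookup-removeAt (x ∷ xs)         zero    j       = refl
lookup-removeAt (x ∷ xs@(_ ∷ _)) (suc p) zero    = refl
lookup-removeAt (x ∷ xs@(_ ∷ _)) (suc p) (suc j) = lookup-removeAt xs p j

module _ {q : ℕ} (F : FiniteField q) where

  open FiniteField F
  open QMatroids F

  private
    variable
      m n k l n₁ n₂ : ℕ
      A X Y Z : Subspace n
      𝒳 : Vec (Subspace n) k

  K : CommutativeRing _ _
  K = record { isCommutativeRing = isCommutativeRing }

  module K where
    open CommutativeRing K public
    open RingProperties ring public

  -- Dimension

  -- Zero and one are distinct. This makes `q ^ k` strictly increasing in `k`, so that counting
  -- vectors compares dimensions.
  1<q : 1 < q
  1<q = 1<∣finite∣ finite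
    where
    -- Stated for an arbitrary cardinality, so that it can be split into 0, 1 and larger values.
    1<∣finite∣ : ∀ {q} → Carrier ↔ Fin q → 1 < q
    1<∣finite∣ {zero}        iso with () ← Inverse.to iso 0#
    1<∣finite∣ {suc zero}    iso = contradiction
      (Injection.injective (↔⇒↣ iso) (all-equal (Inverse.to iso 0#) (Inverse.to iso 1#))) 0≢1
      where
      all-equal : (i j : Fin 1) → i ≡ j
      all-equal zero zero = refl
    1<∣finite∣ {suc (suc _)} _   = s≤s (s≤s z≤n)

  vector↔Fin : ∀ k → Vector k ↔ Fin (q ^ k)
  vector↔Fin zero    = mk↔ₛ′ (λ _ → zero) (λ _ → []) (λ { zero → refl }) (λ { [] → refl })
  vector↔Fin (suc k) = ↔-sym Fin.*↔× ↔-∘ ((finite ×-↔ vector↔Fin k) ↔-∘ uncons)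
    where
    uncons : Vector (suc k) ↔ (Carrier × Vector k)
    uncons = mk↔ₛ′ (λ { (x ∷ v) → x , v }) (λ (x , v) → x ∷ v) (λ _ → refl) (λ { (_ ∷ _) → refl })

  vector-injective⇒≤ : {f : Vector k → Vector m} → Injective _≡_ _≡_ f → k ≤ m
  vector-injective⇒≤ {k} {m} {f} f-injective = ≮⇒≥ λ m<k →
    <⇒≱ (^-monoʳ-< q 1<q m<k) (Fin.injective⇒≤ g-injective)
    where
    g : Fin (q ^ k) → Fin (q ^ m)
    g = Inverse.to (vector↔Fin m) ∘ f ∘ Inverse.from (vector↔Fin k)

    g-injective : Injective _≡_ _≡_ g
    g-injective = Injection.injective (↔⇒↣ (↔-sym (vector↔Fin k)))
                ∘ f-injective ∘ Injection.injective (↔⇒↣ (vector↔Fin m))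

  -- Subtraction of vectors and cancellation in subspaces

  infixl 6 _-ᵛ_

  _-ᵛ_ : Vector n → Vector n → Vector n
  u -ᵛ v = u +ᵛ (-ᶠ 1#) · v

  +ᵛ-comm : (u v : Vector n) → u +ᵛ v ≡ v +ᵛ u
  +ᵛ-comm = zipWith-comm K.+-comm

  +ᵛ-assoc : (u v w : Vector n) → (u +ᵛ v) +ᵛ w ≡ u +ᵛ (v +ᵛ w)
  +ᵛ-assoc = zipWith-assoc K.+-assoc

  v-v≡0 : (v : Vector n) → v -ᵛ v ≡ 0ᵛ
  v-v≡0 []      = refl
  v-v≡0 (x ∷ v) = cong₂ _∷_ (trans (cong (x +ᶠ_) (K.-1*x≈-x x)) (K.-‿inverseʳ x)) (v-v≡0 v)

  u+v-v≡u : (u v : Vector n) → u +ᵛ v -ᵛ v ≡ u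
  u+v-v≡u u v = trans (+ᵛ-assoc u v _) (trans (cong (u +ᵛ_) (v-v≡0 v)) (+ᵛ-identityʳ u))

  u-v+v≡u : (u v : Vector n) → u -ᵛ v +ᵛ v ≡ u
  u-v+v≡u u v = trans (+ᵛ-assoc u _ v)
    (trans (cong (u +ᵛ_) (trans (+ᵛ-comm _ v) (v-v≡0 v))) (+ᵛ-identityʳ u))

  u-v≡0⇒u≡v : {u v : Vector n} → u -ᵛ v ≡ 0ᵛ → u ≡ v
  u-v≡0⇒u≡v {u = u} {v} eq = trans (sym (u-v+v≡u u v)) (trans (cong (_+ᵛ v) eq) (+ᵛ-identityˡ v))

  ·-cancel : ∀ c → c ≢ 0# → ∃ λ d → (v : Vector n) → d · c · v ≡ v
  ·-cancel c c≢0 with inverse c c≢0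
  ... | d , cd≡1 = d , λ v → trans (sym (·-assoc d c v))
    (trans (cong (_· v) (trans (K.*-comm d c) cd≡1)) (·-identityˡ v))

  -ᵛ-closed : (X : Subspace n) {u v : Vector n} → u ∈ X → v ∈ X → u -ᵛ v ∈ X
  -ᵛ-closed X u∈ v∈ = +-closed X u∈ (·-closed X (-ᶠ 1#) v∈)

  ∈-cancelʳ : (X : Subspace n) (u v : Vector n) → u +ᵛ v ∈ X → v ∈ X → u ∈ X
  ∈-cancelʳ X u v u+v∈ v∈ = subst (_∈ X) (u+v-v≡u u v) (-ᵛ-closed X u+v∈ v∈)

  ∈-cancelˡ : (X : Subspace n) (u v : Vector n) → u +ᵛ v ∈ X → u ∈ X → v ∈ X
  ∈-cancelˡ X u v u+v∈ = ∈-cancelʳ X v u (subst (_∈ X) (+ᵛ-comm u v) u+v∈)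

  ∈-cancel-· : (X : Subspace n) {c : Carrier} {v : Vector n} → c ≢ 0# → c · v ∈ X → v ∈ X
  ∈-cancel-· X {c} {v} c≢0 cv∈ with ·-cancel c c≢0
  ... | d , dc≡1 = subst (_∈ X) (dc≡1 v) (·-closed X d cv∈)

  -- The lattice of subspaces

  ⊑-refl : X ⊑ X
  ⊑-refl v v∈ = v∈

  ⊑-trans : X ⊑ Y → Y ⊑ Z → X ⊑ Z
  ⊑-trans X⊑Y Y⊑Z v = Y⊑Z v ∘ X⊑Y v

  X⊑X+Y : (X Y : Subspace n) → X ⊑ X +ˢ Y
  X⊑X+Y X Y v v∈ = v , 0ᵛ , v∈ , 0-closed Y , +ᵛ-identityʳ v

  Y⊑X+Y : (X Y : Subspace n) → Y ⊑ X +ˢ Y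
  Y⊑X+Y X Y v v∈ = 0ᵛ , v , 0-closed X , v∈ , +ᵛ-identityˡ v

  +ˢ-least : {X Y Z : Subspace n} → X ⊑ Z → Y ⊑ Z → X +ˢ Y ⊑ Z
  +ˢ-least {Z = Z} X⊑Z Y⊑Z v (x , y , x∈ , y∈ , refl) = +-closed Z (X⊑Z x x∈) (Y⊑Z y y∈)

  ∩-greatest : {X Y Z : Subspace n} → Z ⊑ X → Z ⊑ Y → Z ⊑ X ∩ Y
  ∩-greatest Z⊑X Z⊑Y v v∈ = Z⊑X v v∈ , Z⊑Y v v∈

  X∩Y⊑X : (X Y : Subspace n) → X ∩ Y ⊑ X
  X∩Y⊑X X Y v = proj₁

  X∩Y⊑Y : (X Y : Subspace n) → X ∩ Y ⊑ Y
  X∩Y⊑Y X Y v = proj₂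

  -- Inclusion is decided by a search through all vectors. The form with a witness serves the
  -- arguments by contradiction that need a vector outside `Y`.
  ∃⊎⊑ : (X Y : Subspace n) → (∃ λ v → v ∈ X × v ∉ Y) ⊎ X ⊑ Y
  ∃⊎⊑ X Y with ∃? (λ v → member? X v ×-dec ¬? (member? Y v))
  ... | yes (v , v∈X , v∉Y) = inj₁ (v , v∈X , v∉Y)
  ... | no  ¬∃ = inj₂ λ v v∈X → decidable-stable (member? Y v) λ v∉Y → ¬∃ (v , v∈X , v∉Y)

  0ˢ : Subspace n
  0ˢ = span []

  0ˢ⊑X : (X : Subspace n) → 0ˢ ⊑ X
  0ˢ⊑X X = span-⊑ {X = X} []

  infixl 6 _+⟨_⟩

  _+⟨_⟩ : Subspace n → Vector n → Subspace n
  X +⟨ v ⟩ = X +ˢ span (v ∷ [])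

  X⊑X+⟨v⟩ : (X : Subspace n) (v : Vector n) → X ⊑ X +⟨ v ⟩
  X⊑X+⟨v⟩ X v = X⊑X+Y X (span (v ∷ []))

  v∈X+⟨v⟩ : (X : Subspace n) (v : Vector n) → v ∈ X +⟨ v ⟩
  v∈X+⟨v⟩ X v = Y⊑X+Y X (span (v ∷ [])) v (span-head v [])

  +⟨⟩-least : {X Z : Subspace n} {v : Vector n} → X ⊑ Z → v ∈ Z → X +⟨ v ⟩ ⊑ Z
  +⟨⟩-least {X = X} {Z} {v} X⊑Z v∈Z =
    +ˢ-least {X = X} {span (v ∷ [])} {Z} X⊑Z (span-⊑ {X = Z} (v∈Z ∷ []))

  ∈-+⟨⟩⁻ : {X : Subspace n} {v w : Vector n} → w ∈ X +⟨ v ⟩ →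
           ∃₂ λ x c → x ∈ X × w ≡ x +ᵛ c · v
  ∈-+⟨⟩⁻ {v = v} (x , _ , x∈ , (c ∷ [] , refl) , refl) = x , c , x∈ , cong (x +ᵛ_) (+ᵛ-identityʳ (c · v))

  ∈-+⟨⟩⁺ : (X : Subspace n) (v : Vector n) {x : Vector n} (c : Carrier) → x ∈ X → x +ᵛ c · v ∈ X +⟨ v ⟩
  ∈-+⟨⟩⁺ X v c x∈ = +-closed (X +⟨ v ⟩) (X⊑X+⟨v⟩ X v _ x∈) (·-closed (X +⟨ v ⟩) c (v∈X+⟨v⟩ X v))

  -- Linear independence, bases and the dimension formula

  lincomb-injective : {xs : Vec (Vector n) l} → LinearlyIndependent xs →
                      ∀ cs ds → lincomb cs xs ≡ lincomb ds xs → cs ≡ ds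
  lincomb-injective {xs = xs} li cs ds eq = u-v≡0⇒u≡v (li (cs -ᵛ ds) (begin
      lincomb (cs -ᵛ ds) xs
        ≡⟨ trans (lincomb-+ cs _ xs) (cong (lincomb cs xs +ᵛ_) (lincomb-· _ ds xs)) ⟩
      lincomb cs xs -ᵛ lincomb ds xs  ≡⟨ cong (_-ᵛ lincomb ds xs) eq ⟩
      lincomb ds xs -ᵛ lincomb ds xs  ≡⟨ v-v≡0 _ ⟩
      0ᵛ                              ∎))
    where open ≡-Reasoning

  -- A linearly independent family embeds its coefficient vectors into those of
  -- any spanning family, so counting compares their lengths.
  independent⇒≤ : {us : Vec (Vector n) k} {vs : Vec (Vector n) m} →
                  LinearlyIndependent us → span us ⊑ span vs → k ≤ m
  independent⇒≤ {k = k} {us = us} {vs} li us⊑vs = vector-injective⇒≤ coefficients-injective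
    where
    coefficients : Vec Carrier k → Vec Carrier _
    coefficients cs = proj₁ (us⊑vs (lincomb cs us) (cs , refl))

    coefficients-injective : Injective _≡_ _≡_ coefficients
    coefficients-injective {cs} {ds} eq = lincomb-injective li cs ds
      (trans (sym (proj₂ (us⊑vs _ (cs , refl))))
        (trans (cong (λ es → lincomb es vs) eq) (proj₂ (us⊑vs _ (ds , refl)))))

  independent⇒≤dim : {vs : Vec (Vector n) k} → LinearlyIndependent vs → span vs ⊑ X → k ≤ dim X
  independent⇒≤dim {X = X} {vs} li vs⊑X =
    independent⇒≤ li (⊑-trans {X = span vs} {X} {span (basis X)} vs⊑X (proj₂ (proj₂ (basis-isBasis X))))

  dim-mono : (X Y : Subspace n) → X ⊑ Y → dim X ≤ dim Y
  dim-mono X Y X⊑Y with basis-isBasis X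
  ... | li , sp , _ = independent⇒≤dim {X = Y} li (⊑-trans {X = span (basis X)} {X} {Y} sp X⊑Y)

  dim-≐ : (X Y : Subspace n) → X ≐ Y → dim X ≡ dim Y
  dim-≐ X Y (X⊑Y , Y⊑X) = ≤-antisym (dim-mono X Y X⊑Y) (dim-mono Y X Y⊑X)

  dim-basis : (X : Subspace n) {vs : Vec (Vector n) k} → IsBasis X vs → dim X ≡ k
  dim-basis X {vs} (li , vs⊑X , X⊑vs) with basis-isBasis X
  ... | li′ , sp , _ = ≤-antisym
    (independent⇒≤ li′ (⊑-trans {X = span (basis X)} {X} {span vs} sp X⊑vs))
    (independent⇒≤dim {X = X} li vs⊑X)

  dim-span : (vs : Vec (Vector n) k) → LinearlyIndependent vs → dim (span vs) ≡ k
  dim-span vs li = dim-basis (span vs) (li , ⊑-refl {X = span vs} , ⊑-refl {X = span vs})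

  dim-0ˢ : ∀ n → dim (0ˢ {n}) ≡ 0
  dim-0ˢ n = dim-span {n = n} [] λ { [] _ → refl }

  ∷-isBasis : {X : Subspace n} {v : Vector n} {vs : Vec (Vector n) k} →
              v ∉ X → IsBasis X vs → IsBasis (X +⟨ v ⟩) (v ∷ vs)
  ∷-isBasis {X = X} {v} {vs} v∉X (li , vs⊑X , X⊑vs) =
    LI-∷ (v∉X ∘ vs⊑X v) li ,
    (λ { _ (c ∷ cs , refl) → +-closed (X +⟨ v ⟩) (·-closed (X +⟨ v ⟩) c (v∈X+⟨v⟩ X v))
                                (X⊑X+⟨v⟩ X v _ (vs⊑X _ (cs , refl))) }) ,
    +⟨⟩-least {X = X} {span (v ∷ vs)} (λ w → span-tail v vs w ∘ X⊑vs w) (span-head v vs)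

  dim-+⟨⟩ : {X : Subspace n} {v : Vector n} → v ∉ X → dim (X +⟨ v ⟩) ≡ suc (dim X)
  dim-+⟨⟩ {X = X} {v} v∉X = dim-basis (X +⟨ v ⟩) (∷-isBasis {X = X} v∉X (basis-isBasis X))

  dim-< : {X Y : Subspace n} {v : Vector n} → X ⊑ Y → v ∈ Y → v ∉ X → dim X < dim Y
  dim-< {X = X} {Y} {v} X⊑Y v∈Y v∉X = subst (_≤ dim Y) (dim-+⟨⟩ {X = X} v∉X)
    (dim-mono (X +⟨ v ⟩) Y (+⟨⟩-least {X = X} {Y} X⊑Y v∈Y))

  -- Climb from `X` to `Y` through a list of all elements of `Y`, adjoining each one that is not yet
  -- present. The space reached at the end agrees with `Y` only up to `≐`, hence the condition that
  -- `P` respects `≐`.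
  subspace-induction : ∀ {p} (P : Subspace n → Set p) →
    (∀ X Y → X ≐ Y → P X → P Y) → {X Y : Subspace n} → X ⊑ Y → P X →
    (∀ Z v → X ⊑ Z → Z ⊑ Y → v ∈ Y → v ∉ Z → P Z → P (Z +⟨ v ⟩)) → P Y
  subspace-induction P resp {X} {Y} X⊑Y PX step =
    let Z , _ , Z⊑Y , vs∈Z , PZ = extend (All.all-filter (member? Y) (vectors _))
    in resp Z Y (Z⊑Y , λ v v∈Y → All.lookup vs∈Z (List.∈-filter⁺ (member? Y) (∈-vectors v) v∈Y)) PZ
    where
    extend : ∀ {vs} → All (_∈ Y) vs → Σ (Subspace _) λ Z → X ⊑ Z × Z ⊑ Y × All (_∈ Z) vs × P Z
    extend [] = X , ⊑-refl {X = X} , X⊑Y , [] , PX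
    extend {v ∷ _} (v∈Y ∷ vs∈Y) with extend vs∈Y
    ... | Z , X⊑Z , Z⊑Y , vs∈Z , PZ with member? Z v
    ...   | yes v∈Z = Z , X⊑Z , Z⊑Y , v∈Z ∷ vs∈Z , PZ
    ...   | no  v∉Z = Z +⟨ v ⟩ , ⊑-trans {X = X} {Z} {Z +⟨ v ⟩} X⊑Z (X⊑X+⟨v⟩ Z v) ,
                    +⟨⟩-least {X = Z} {Y} Z⊑Y v∈Y ,
                    v∈X+⟨v⟩ Z v ∷ All.map (X⊑X+⟨v⟩ Z v _) vs∈Z , step Z v X⊑Z Z⊑Y v∈Y v∉Z PZ

  -- An element of the left side that involves `v` with a nonzero coefficient would put `v` into
  -- `X +ˢ Y`.
  ∩-+⟨⟩-∉ : (X Y : Subspace n) {v : Vector n} → v ∉ X +ˢ Y → X ∩ (Y +⟨ v ⟩) ⊑ X ∩ Y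
  ∩-+⟨⟩-∉ X Y {v} v∉X+Y w (w∈X , w∈Y+v) with ∈-+⟨⟩⁻ {X = Y} w∈Y+v
  ... | y , c , y∈Y , refl with c ≟ᶠ 0#
  ...   | yes refl = w∈X , subst (_∈ Y) (sym (trans (cong (y +ᵛ_) (·-zeroˡ v)) (+ᵛ-identityʳ y))) y∈Y
  ...   | no  c≢0  = contradiction
    (∈-cancel-· (X +ˢ Y) c≢0
      (∈-cancelˡ (X +ˢ Y) y (c · v) (X⊑X+Y X Y _ w∈X) (Y⊑X+Y X Y y y∈Y)))
    v∉X+Y

  -- Adjoining `x +ᵛ y` to `Y` amounts to adjoining `x`, which lies in `X`; this is then an instance
  -- of the modular law.
  ∩-+⟨⟩-∈ : (X Y : Subspace n) {x y : Vector n} → x ∈ X → y ∈ Y →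
            X ∩ (Y +⟨ x +ᵛ y ⟩) ≐ (X ∩ Y) +⟨ x ⟩
  ∩-+⟨⟩-∈ X Y {x} {y} x∈X y∈Y = forth , back
    where
    forth : X ∩ (Y +⟨ x +ᵛ y ⟩) ⊑ (X ∩ Y) +⟨ x ⟩
    forth w (w∈X , w∈) with ∈-+⟨⟩⁻ {X = Y} w∈
    ... | y′ , c , y′∈Y , refl = subst (_∈ (X ∩ Y) +⟨ x ⟩) (sym regroup)
          (∈-+⟨⟩⁺ (X ∩ Y) x c (∈-cancelʳ X y″ (c · x) (subst (_∈ X) regroup w∈X) (·-closed X c x∈X)
                              , +-closed Y y′∈Y (·-closed Y c y∈Y)))
      where
      -- All of the element that comes from `Y`; the rest is `c · x`, so `y″` is also in `X`.
      y″ = y′ +ᵛ c · y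
      regroup : y′ +ᵛ c · (x +ᵛ y) ≡ y″ +ᵛ c · x
      regroup = trans (cong (y′ +ᵛ_) (trans (·-distribˡ c x y) (+ᵛ-comm _ _))) (sym (+ᵛ-assoc y′ _ _))

    back : (X ∩ Y) +⟨ x ⟩ ⊑ X ∩ (Y +⟨ x +ᵛ y ⟩)
    back = +⟨⟩-least {X = X ∩ Y} {X ∩ (Y +⟨ x +ᵛ y ⟩)}
          (λ w (w∈X , w∈Y) → w∈X , X⊑X+⟨v⟩ Y (x +ᵛ y) w w∈Y)
          (x∈X , ∈-cancelʳ (Y +⟨ x +ᵛ y ⟩) x y (v∈X+⟨v⟩ Y (x +ᵛ y)) (X⊑X+⟨v⟩ Y (x +ᵛ y) y y∈Y))

  +ˢ-assoc-+⟨⟩ : (X Y : Subspace n) (v : Vector n) → X +ˢ (Y +⟨ v ⟩) ≐ (X +ˢ Y) +⟨ v ⟩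
  +ˢ-assoc-+⟨⟩ X Y v =
    (λ { _ (x , _ , x∈ , (y , w , y∈ , w∈ , refl) , refl) →
         x +ᵛ y , w , (x , y , x∈ , y∈ , refl) , w∈ , +ᵛ-assoc x y w }) ,
    (λ { _ (_ , w , (x , y , x∈ , y∈ , refl) , w∈ , refl) →
         x , y +ᵛ w , x∈ , (y , w , y∈ , w∈ , refl) , sym (+ᵛ-assoc x y w) })

  +ˢ-mono : {X X′ Y Y′ : Subspace n} → X ⊑ X′ → Y ⊑ Y′ → X +ˢ Y ⊑ X′ +ˢ Y′
  +ˢ-mono X⊑X′ Y⊑Y′ v (x , y , x∈ , y∈ , eq) = x , y , X⊑X′ x x∈ , Y⊑Y′ y y∈ , eq

  ∩-mono : {X X′ Y Y′ : Subspace n} → X ⊑ X′ → Y ⊑ Y′ → X ∩ Y ⊑ X′ ∩ Y′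
  ∩-mono X⊑X′ Y⊑Y′ v (v∈X , v∈Y) = X⊑X′ v v∈X , Y⊑Y′ v v∈Y

  -- Build up `Y` one vector at a time. A new vector outside `X +ˢ Z` enlarges the sum and keeps the
  -- intersection. A new vector `x +ᵛ z` inside it keeps the sum and enlarges the intersection by
  -- `x`.
  dim-modular : (X Y : Subspace n) → dim (X +ˢ Y) + dim (X ∩ Y) ≡ dim X + dim Y
  dim-modular {n} X Y = subspace-induction P P-resp {0ˢ} {Y} (0ˢ⊑X Y) base step
    where
    P : Subspace n → Set
    P Z = dim (X +ˢ Z) + dim (X ∩ Z) ≡ dim X + dim Z

    P-resp : ∀ Z Z′ → Z ≐ Z′ → P Z → P Z′
    P-resp Z Z′ eq@(Z⊑Z′ , Z′⊑Z) = subst₂ _≡_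
      (cong₂ _+_
        (dim-≐ (X +ˢ Z) (X +ˢ Z′) (+ˢ-mono {X = X} {X} {Z} {Z′} (⊑-refl {X = X}) Z⊑Z′
                                  , +ˢ-mono {X = X} {X} {Z′} {Z} (⊑-refl {X = X}) Z′⊑Z))
        (dim-≐ (X ∩ Z) (X ∩ Z′) (∩-mono {X = X} {X} {Z} {Z′} (⊑-refl {X = X}) Z⊑Z′
                                , ∩-mono {X = X} {X} {Z′} {Z} (⊑-refl {X = X}) Z′⊑Z)))
      (cong (dim X +_) (dim-≐ Z Z′ eq))

    base : P 0ˢ
    base = cong₂ _+_
      (dim-≐ (X +ˢ 0ˢ) X (+ˢ-least {X = X} {0ˢ} {X} (⊑-refl {X = X}) (0ˢ⊑X X) , X⊑X+Y X 0ˢ))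
      (dim-≐ (X ∩ 0ˢ) 0ˢ (X∩Y⊑Y X 0ˢ , ∩-greatest {X = X} {0ˢ} {0ˢ} (0ˢ⊑X X) (⊑-refl {X = 0ˢ})))

    step : ∀ Z v → 0ˢ ⊑ Z → Z ⊑ Y → v ∈ Y → v ∉ Z → P Z → P (Z +⟨ v ⟩)
    step Z v _ _ _ v∉Z PZ with member? (X +ˢ Z) v
    ... | no v∉X+Z = begin
      dim (X +ˢ (Z +⟨ v ⟩)) + dim (X ∩ (Z +⟨ v ⟩))
        ≡⟨ cong₂ _+_
             (trans (dim-≐ (X +ˢ (Z +⟨ v ⟩)) ((X +ˢ Z) +⟨ v ⟩) (+ˢ-assoc-+⟨⟩ X Z v))
                    (dim-+⟨⟩ {X = X +ˢ Z} v∉X+Z))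
             (dim-≐ (X ∩ (Z +⟨ v ⟩)) (X ∩ Z) (∩-+⟨⟩-∉ X Z v∉X+Z ,
               ∩-mono {X = X} {X} {Z} {Z +⟨ v ⟩} (⊑-refl {X = X}) (X⊑X+⟨v⟩ Z v))) ⟩
      suc (dim (X +ˢ Z)) + dim (X ∩ Z)  ≡⟨ cong suc PZ ⟩
      suc (dim X + dim Z)               ≡⟨ +-suc (dim X) (dim Z) ⟨
      dim X + suc (dim Z)               ≡⟨ cong (dim X +_) (dim-+⟨⟩ {X = Z} v∉Z) ⟨
      dim X + dim (Z +⟨ v ⟩)            ∎
      where open ≡-Reasoning
    ... | yes (x , z , x∈X , z∈Z , refl) = begin
      dim (X +ˢ (Z +⟨ x +ᵛ z ⟩)) + dim (X ∩ (Z +⟨ x +ᵛ z ⟩))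
        ≡⟨ cong₂ _+_ (dim-≐ (X +ˢ (Z +⟨ x +ᵛ z ⟩)) (X +ˢ Z)
              ( ⊑-trans {X = X +ˢ (Z +⟨ x +ᵛ z ⟩)} {(X +ˢ Z) +⟨ x +ᵛ z ⟩} {X +ˢ Z}
                  (proj₁ (+ˢ-assoc-+⟨⟩ X Z (x +ᵛ z)))
                  (+⟨⟩-least {X = X +ˢ Z} {X +ˢ Z} (⊑-refl {X = X +ˢ Z}) (x , z , x∈X , z∈Z , refl))
              , +ˢ-mono {X = X} {X} {Z} {Z +⟨ x +ᵛ z ⟩} (⊑-refl {X = X}) (X⊑X+⟨v⟩ Z _)))
             (trans (dim-≐ (X ∩ (Z +⟨ x +ᵛ z ⟩)) ((X ∩ Z) +⟨ x ⟩) (∩-+⟨⟩-∈ X Z x∈X z∈Z))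
               (dim-+⟨⟩ {X = X ∩ Z} λ (_ , x∈Z) → v∉Z (+-closed Z x∈Z z∈Z))) ⟩
      dim (X +ˢ Z) + suc (dim (X ∩ Z))  ≡⟨ +-suc (dim (X +ˢ Z)) _ ⟩
      suc (dim (X +ˢ Z) + dim (X ∩ Z))  ≡⟨ cong suc PZ ⟩
      suc (dim X + dim Z)               ≡⟨ +-suc (dim X) (dim Z) ⟨
      dim X + suc (dim Z)               ≡⟨ cong (dim X +_) (dim-+⟨⟩ {X = Z} v∉Z) ⟨
      dim X + dim (Z +⟨ x +ᵛ z ⟩)       ∎
      where open ≡-Reasoning

  -- Bases and dimension of direct sums of subspaces

  0ᵛ-++ : ∀ m {n} → 0ᵛ {m} ++ 0ᵛ {n} ≡ 0ᵛ
  0ᵛ-++ zero    = refl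
  0ᵛ-++ (suc m) = cong (0# ∷_) (0ᵛ-++ m)

  ·-++ : ∀ c (u : Vector m) (v : Vector n) → c · (u ++ v) ≡ c · u ++ c · v
  ·-++ c u v = map-++ (c *ᶠ_) u v

  +ᵛ-++ : (u u′ : Vector m) (v v′ : Vector n) → (u ++ v) +ᵛ (u′ ++ v′) ≡ (u +ᵛ u′) ++ (v +ᵛ v′)
  +ᵛ-++ []      []        v v′ = refl
  +ᵛ-++ (a ∷ u) (a′ ∷ u′) v v′ = cong (_ ∷_) (+ᵛ-++ u u′ v v′)

  take-drop-++ : (u : Vector m) (v : Vector n) → take m (u ++ v) ≡ u × drop m (u ++ v) ≡ v
  take-drop-++ {m} u v = ++-injective (take m (u ++ v)) u (take++drop≡id m (u ++ v))

  ∈-⊕⁺ : {X : Subspace m} {Y : Subspace n} {u : Vector m} {v : Vector n} →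
         u ∈ X → v ∈ Y → u ++ v ∈ X ⊕ Y
  ∈-⊕⁺ {X = X} {Y} {u} {v} u∈X v∈Y with tk , dr ← take-drop-++ u v =
    subst (_∈ X) (sym tk) u∈X , subst (_∈ Y) (sym dr) v∈Y

  ⊕-vectors : Vec (Vector m) k → Vec (Vector n) n₁ → Vec (Vector (m + n)) (k + n₁)
  ⊕-vectors us vs = Vec.map (_++ 0ᵛ) us ++ Vec.map (0ᵛ ++_) vs

  lincomb-⊕ : (cs : Vec Carrier k) (ds : Vec Carrier n₁) (us : Vec (Vector m) k) (vs : Vec (Vector n) n₁) →
              lincomb (cs ++ ds) (⊕-vectors us vs) ≡ lincomb cs us ++ lincomb ds vs
  lincomb-⊕ {m = m} [] []       [] []       = sym (0ᵛ-++ m)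
  lincomb-⊕ {m = m} [] (d ∷ ds) [] (v ∷ vs) = begin
    d · (0ᵛ ++ v) +ᵛ lincomb ds (Vec.map (0ᵛ ++_) vs)
      ≡⟨ cong₂ _+ᵛ_ (·-++ d 0ᵛ v) (lincomb-⊕ [] ds [] vs) ⟩
    (d · 0ᵛ ++ d · v) +ᵛ (0ᵛ ++ lincomb ds vs)
      ≡⟨ +ᵛ-++ (d · 0ᵛ) 0ᵛ (d · v) _ ⟩
    (d · 0ᵛ +ᵛ 0ᵛ) ++ (d · v +ᵛ lincomb ds vs)
      ≡⟨ cong (_++ (d · v +ᵛ lincomb ds vs)) (trans (+ᵛ-identityʳ _) (·-zeroʳ d)) ⟩
    0ᵛ {m} ++ (d · v +ᵛ lincomb ds vs) ∎
    where open ≡-Reasoning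
  lincomb-⊕ (c ∷ cs) ds (u ∷ us) vs = begin
    c · (u ++ 0ᵛ) +ᵛ lincomb (cs ++ ds) (⊕-vectors us vs)
      ≡⟨ cong₂ _+ᵛ_ (·-++ c u 0ᵛ) (lincomb-⊕ cs ds us vs) ⟩
    (c · u ++ c · 0ᵛ) +ᵛ (lincomb cs us ++ lincomb ds vs)
      ≡⟨ +ᵛ-++ (c · u) _ _ _ ⟩
    (c · u +ᵛ lincomb cs us) ++ (c · 0ᵛ +ᵛ lincomb ds vs)
      ≡⟨ cong ((c · u +ᵛ lincomb cs us) ++_)
           (trans (cong (_+ᵛ lincomb ds vs) (·-zeroʳ c)) (+ᵛ-identityˡ _)) ⟩
    (c · u +ᵛ lincomb cs us) ++ lincomb ds vs ∎
    where open ≡-Reasoning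

  ⊕-isBasis : {X : Subspace m} {Y : Subspace n} {us : Vec (Vector m) k} {vs : Vec (Vector n) n₁} →
              IsBasis X us → IsBasis Y vs → IsBasis (X ⊕ Y) (⊕-vectors us vs)
  ⊕-isBasis {m = m} {k = k} {X = X} {Y} {us} {vs} (liX , us⊑X , X⊑us) (liY , vs⊑Y , Y⊑vs) =
    li , span⊑ , ⊑span
    where
    split-lincomb : ∀ es → lincomb es (⊕-vectors us vs) ≡ lincomb (take k es) us ++ lincomb (drop k es) vs
    split-lincomb es = trans (cong (λ es → lincomb es (⊕-vectors us vs)) (sym (take++drop≡id k es)))
                             (lincomb-⊕ (take k es) (drop k es) us vs)

    li : LinearlyIndependent (⊕-vectors us vs)
    li es eq
      with l , r ← ++-injective (lincomb (take k es) us) 0ᵛ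
                     (trans (sym (split-lincomb es)) (trans eq (sym (0ᵛ-++ m)))) =
      trans (sym (take++drop≡id k es)) (trans (cong₂ _++_ (liX (take k es) l) (liY (drop k es) r)) (0ᵛ-++ k))

    span⊑ : span (⊕-vectors us vs) ⊑ X ⊕ Y
    span⊑ _ (es , refl) = subst (_∈ X ⊕ Y) (sym (split-lincomb es))
      (∈-⊕⁺ {X = X} {Y} (us⊑X _ (take k es , refl)) (vs⊑Y _ (drop k es , refl)))

    ⊑span : X ⊕ Y ⊑ span (⊕-vectors us vs)
    ⊑span w (w₁∈X , w₂∈Y) with cs , cs-eq ← X⊑us _ w₁∈X | ds , ds-eq ← Y⊑vs _ w₂∈Y =
      cs ++ ds , trans (lincomb-⊕ cs ds us vs) (trans (cong₂ _++_ cs-eq ds-eq) (take++drop≡id m w))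

  dim-⊕ : (X : Subspace m) (Y : Subspace n) → dim (X ⊕ Y) ≡ dim X + dim Y
  dim-⊕ X Y = dim-basis (X ⊕ Y) (⊕-isBasis {X = X} {Y} (basis-isBasis X) (basis-isBasis Y))

  -- Rank functions induced by polymatroids

  -- An integer-valued q-polymatroid. In place of the bound by `dim` only the value at the zero
  -- subspace is fixed, since the count of a presentation may exceed the dimension.
  record IsPolymatroid (f : RankFunction n) : Set₁ where
    field
      zero-0ˢ    : f 0ˢ ≡ 0
      monotone   : ∀ X Y → X ⊑ Y → f X ≤ f Y
      submodular : ∀ X Y → f (X +ˢ Y) + f (X ∩ Y) ≤ f X + f Y

  -- Written with the same default and the same list as `_⊕ʳ_`, so that the direct sum is an
  -- instance by definition.
  induced : RankFunction n → RankFunction n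
  induced f X = min (value X) (List.map value (subspacesOf X))
    where
    value : Subspace _ → ℕ
    value Y = f Y + (dim X ∸ dim Y)

  private
    -- The truncated subtraction loses nothing because `dim Y ≤ dim X`. From here on dimensions are
    -- moved across the relation, so that no subtraction remains.
    exact : {X Y : Subspace n} → Y ⊑ X → ∀ a → a + (dim X ∸ dim Y) + dim Y ≡ a + dim X
    exact {X = X} {Y} Y⊑X a = trans (+-assoc a _ _) (cong (a +_) (m∸n+n≡m (dim-mono Y X Y⊑X)))

  induced-attained : (f : RankFunction n) (X : Subspace n) →
                     Σ (Subspace n) λ Y → Y ⊑ X × induced f X + dim Y ≡ f Y + dim X
  induced-attained f X = argmin-all id
    {P = λ r → Σ (Subspace _) λ Y → Y ⊑ X × r + dim Y ≡ f Y + dim X}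
    (X , ⊑-refl {X = X} , exact {X = X} {X} (⊑-refl {X = X}) (f X))
    (All.map⁺ (All.map (λ {Y} Y⊑X → Y , Y⊑X , exact {X = X} {Y} Y⊑X (f Y)) (subspacesOf-sound X)))

  module _ {f : RankFunction n} (f-polymatroid : IsPolymatroid f) where

    open IsPolymatroid f-polymatroid

    -- The list of subspaces meets `Y` only up to `≐`; monotonicity of `f` and of `dim` carries the
    -- bound over to `Y` itself.
    induced-least : (X Y : Subspace n) → Y ⊑ X → induced f X + dim Y ≤ f Y + dim X
    induced-least X Y Y⊑X = subst (induced f X + dim Y ≤_) (exact {X = X} {Y} Y⊑X (f Y))
      (+-monoˡ-≤ (dim Y) (min≤v⁺ _ _ (inj₂ (Any.map⁺ (Any.map bound (subspacesOf-complete X Y Y⊑X))))))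
      where
      bound : {Z : Subspace n} → Z ≐ Y → f Z + (dim X ∸ dim Z) ≤ f Y + (dim X ∸ dim Y)
      bound {Z} (Z⊑Y , Y⊑Z) = +-mono-≤ (monotone Z Y Z⊑Y) (∸-monoʳ-≤ (dim X) (dim-mono Y Z Y⊑Z))

    induced-≤ : (X : Subspace n) → induced f X ≤ f X
    induced-≤ X = +-cancelʳ-≤ (dim X) _ _ (induced-least X X (⊑-refl {X = X}))

    induced-isQMatroid : IsQMatroid (induced f)
    induced-isQMatroid = record { bounded = bounded′ ; monotone = monotone′ ; submodular = submodular′ }
      where
      bounded′ : ∀ X → induced f X ≤ dim X
      bounded′ X = begin
        induced f X                 ≤⟨ m≤m+n _ _ ⟩
        induced f X + dim (0ˢ {n})  ≤⟨ induced-least X 0ˢ (0ˢ⊑X X) ⟩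
        f 0ˢ + dim X                ≡⟨ cong (_+ dim X) zero-0ˢ ⟩
        dim X                       ∎
        where open ≤-Reasoning

      monotone′ : ∀ X Y → X ⊑ Y → induced f X ≤ induced f Y
      -- The competitor for `X` is `X ∩ B`: its codimension in `X` is that of `B` in `X +ˢ B`, hence
      -- at most that of `B` in `Y`.
      monotone′ X Y X⊑Y with B , B⊑Y , attained ← induced-attained f Y =
        +-cancelʳ-≤ (dim (X ∩ B) + dim Y) _ _ (begin
          induced f X + (dim (X ∩ B) + dim Y)
            ≡⟨ +-assoc (induced f X) _ _ ⟨
          induced f X + dim (X ∩ B) + dim Y
            ≤⟨ +-monoˡ-≤ (dim Y) (induced-least X (X ∩ B) (X∩Y⊑X X B)) ⟩
          f (X ∩ B) + dim X + dim Y
            ≡⟨ xy∙z≈xz∙y (f (X ∩ B)) (dim X) (dim Y) ⟩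
          f (X ∩ B) + dim Y + dim X
            ≤⟨ +-monoˡ-≤ (dim X) (+-monoˡ-≤ (dim Y) (monotone (X ∩ B) B (X∩Y⊑Y X B))) ⟩
          f B + dim Y + dim X
            ≡⟨ cong (_+ dim X) attained ⟨
          induced f Y + dim B + dim X
            ≡⟨ trans (+-assoc (induced f Y) _ _) (cong (induced f Y +_) (+-comm (dim B) (dim X))) ⟩
          induced f Y + (dim X + dim B)
            ≡⟨ cong (induced f Y +_) (dim-modular X B) ⟨
          induced f Y + (dim (X +ˢ B) + dim (X ∩ B))
            ≤⟨ +-monoʳ-≤ (induced f Y) (+-monoˡ-≤ (dim (X ∩ B))
                 (dim-mono (X +ˢ B) Y (+ˢ-least {X = X} {B} {Y} X⊑Y B⊑Y))) ⟩
          induced f Y + (dim Y + dim (X ∩ B))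
            ≡⟨ cong (induced f Y +_) (+-comm (dim Y) _) ⟩
          induced f Y + (dim (X ∩ B) + dim Y) ∎)
        where open ≤-Reasoning

      submodular′ : ∀ X Y → induced f (X +ˢ Y) + induced f (X ∩ Y) ≤ induced f X + induced f Y
      submodular′ X Y with induced-attained f X | induced-attained f Y
      -- `A +ˢ B` and `A ∩ B` compete for `X +ˢ Y` and `X ∩ Y`. The dimensions on the two sides
      -- balance by the dimension formula, which leaves the submodularity of `f`.
      ... | A , A⊑X , attainedA | B , B⊑Y , attainedB =
        +-cancelʳ-≤ (dim (A +ˢ B) + dim (A ∩ B)) _ _ (begin
          (induced f (X +ˢ Y) + induced f (X ∩ Y)) + (dim (A +ˢ B) + dim (A ∩ B))
            ≡⟨ interchange (induced f (X +ˢ Y)) _ _ _ ⟩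
          (induced f (X +ˢ Y) + dim (A +ˢ B)) + (induced f (X ∩ Y) + dim (A ∩ B))
            ≤⟨ +-mono-≤ (induced-least (X +ˢ Y) (A +ˢ B) (+ˢ-mono {X = A} {X} {B} {Y} A⊑X B⊑Y))
                        (induced-least (X ∩ Y) (A ∩ B) (∩-mono {X = A} {X} {B} {Y} A⊑X B⊑Y)) ⟩
          (f (A +ˢ B) + dim (X +ˢ Y)) + (f (A ∩ B) + dim (X ∩ Y))
            ≡⟨ interchange (f (A +ˢ B)) _ _ _ ⟩
          (f (A +ˢ B) + f (A ∩ B)) + (dim (X +ˢ Y) + dim (X ∩ Y))
            ≤⟨ +-mono-≤ (submodular A B) (≤-reflexive (dim-modular X Y)) ⟩
          (f A + f B) + (dim X + dim Y)
            ≡⟨ interchange (f A) _ _ _ ⟩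
          (f A + dim X) + (f B + dim Y)
            ≡⟨ cong₂ _+_ attainedA attainedB ⟨
          (induced f X + dim A) + (induced f Y + dim B)
            ≡⟨ interchange (induced f X) _ _ _ ⟩
          (induced f X + induced f Y) + (dim A + dim B)
            ≡⟨ cong (induced f X + induced f Y +_) (dim-modular A B) ⟨
          (induced f X + induced f Y) + (dim (A +ˢ B) + dim (A ∩ B)) ∎)
        where open ≤-Reasoning

    -- The value that `Y` contributes to the minimum falls below `dim X` exactly when `f Y < dim Y`.
    induced-independent : (X : Subspace n) →
                          Independent (induced f) X ⇔ (∀ Y → Y ⊑ X → dim Y ≤ f Y)
    induced-independent X = mk⇔ ⇒ ⇐
      where
      ⇒ : induced f X ≡ dim X → ∀ Y → Y ⊑ X → dim Y ≤ f Y
      ⇒ eq Y Y⊑X = +-cancelˡ-≤ (dim X) _ _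
        (subst₂ (λ a b → a + dim Y ≤ b) eq (+-comm (f Y) (dim X)) (induced-least X Y Y⊑X))

      ⇐ : (∀ Y → Y ⊑ X → dim Y ≤ f Y) → induced f X ≡ dim X
      ⇐ dim≤f with Y , Y⊑X , attained ← induced-attained f X =
        ≤-antisym (IsQMatroid.bounded induced-isQMatroid X)
          (+-cancelˡ-≤ (dim Y) _ _ (begin
            dim Y + dim X        ≤⟨ +-monoˡ-≤ (dim X) (dim≤f Y Y⊑X) ⟩
            f Y + dim X          ≡⟨ attained ⟨
            induced f X + dim Y  ≡⟨ +-comm (induced f X) (dim Y) ⟩
            dim Y + induced f X  ∎))
        where open ≤-Reasoning

  -- Rank functions are determined by their independent spaces

  dim-span-≤ : (vs : Vec (Vector n) k) → dim (span vs) ≤ k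
  dim-span-≤ vs with li , sp , _ ← basis-isBasis (span vs) = independent⇒≤ li sp

  module _ {ρ : RankFunction n} (ρ-isQMatroid : IsQMatroid ρ) where

    open IsQMatroid ρ-isQMatroid

    -- Greedy construction along a chain up to `X`. If the new vector does not raise the rank of
    -- `I`, submodularity shows that `ρ I` still bounds the rank of the larger space; otherwise it
    -- is adjoined to `I`.
    rank-attained : ∀ X → Σ (Subspace n) λ I → I ⊑ X × Independent ρ I × ρ X ≤ ρ I
    rank-attained X = subspace-induction P
      (λ Z Z′ (Z⊑Z′ , Z′⊑Z) (I , I⊑Z , ind , ρZ≤ρI) →
        I , ⊑-trans {X = I} {Z} {Z′} I⊑Z Z⊑Z′ , ind , ≤-trans (monotone Z′ Z Z′⊑Z) ρZ≤ρI)
      {0ˢ} {X} (0ˢ⊑X X)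
      (0ˢ , ⊑-refl {X = 0ˢ} , ≤-antisym (bounded 0ˢ) (≤-trans (≤-reflexive (dim-0ˢ n)) z≤n) , ≤-refl)
      step
      where
      open ≤-Reasoning

      P : Subspace n → Set₁
      P Z = Σ (Subspace n) λ I → I ⊑ Z × Independent ρ I × ρ Z ≤ ρ I

      step : ∀ Z v → 0ˢ ⊑ Z → Z ⊑ X → v ∈ X → v ∉ Z → P Z → P (Z +⟨ v ⟩)
      step Z v _ _ _ v∉Z (I , I⊑Z , ind , ρZ≤ρI) with ρ (I +⟨ v ⟩) ≤? ρ I
      ... | yes ρI+v≤ρI = I , ⊑-trans {X = I} {Z} {Z +⟨ v ⟩} I⊑Z (X⊑X+⟨v⟩ Z v) , ind ,
        +-cancelʳ-≤ (ρ I) _ _ (begin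
          ρ (Z +⟨ v ⟩) + ρ I
            ≤⟨ +-mono-≤
                 (monotone (Z +⟨ v ⟩) (Z +ˢ (I +⟨ v ⟩))
                   (+ˢ-mono {X = Z} {Z} {span (v ∷ [])} {I +⟨ v ⟩} (⊑-refl {X = Z}) (Y⊑X+Y I (span (v ∷ [])))))
                 (monotone I (Z ∩ (I +⟨ v ⟩)) (∩-greatest {X = Z} {I +⟨ v ⟩} {I} I⊑Z (X⊑X+⟨v⟩ I v))) ⟩
          ρ (Z +ˢ (I +⟨ v ⟩)) + ρ (Z ∩ (I +⟨ v ⟩))  ≤⟨ submodular Z (I +⟨ v ⟩) ⟩
          ρ Z + ρ (I +⟨ v ⟩)                        ≤⟨ +-mono-≤ ρZ≤ρI ρI+v≤ρI ⟩
          ρ I + ρ I                                 ∎)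
      ... | no  ρI+v≰ρI = I +⟨ v ⟩ ,
        +ˢ-mono {X = I} {Z} {span (v ∷ [])} {span (v ∷ [])} I⊑Z (⊑-refl {X = span (v ∷ [])}) ,
        ≤-antisym (bounded (I +⟨ v ⟩)) (begin
          dim (I +⟨ v ⟩)  ≡⟨ dim-+⟨⟩ {X = I} (v∉Z ∘ I⊑Z v) ⟩
          suc (dim I)     ≡⟨ cong suc ind ⟨
          suc (ρ I)       ≤⟨ ≰⇒> ρI+v≰ρI ⟩
          ρ (I +⟨ v ⟩)    ∎) ,
        (begin
          -- A single vector raises the rank of `Z` by at most one, and it raises that of `I` by at
          -- least one.
          ρ (Z +⟨ v ⟩)                               ≤⟨ m≤m+n _ _ ⟩
          ρ (Z +⟨ v ⟩) + ρ (Z ∩ span (v ∷ []))       ≤⟨ submodular Z (span (v ∷ [])) ⟩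
          ρ Z + ρ (span (v ∷ []))                    ≤⟨ +-mono-≤ ρZ≤ρI (≤-trans (bounded (span (v ∷ [])))
                                                                       (dim-span-≤ (v ∷ []))) ⟩
          ρ I + 1                                    ≡⟨ +-comm (ρ I) 1 ⟩
          suc (ρ I)                                  ≤⟨ ≰⇒> ρI+v≰ρI ⟩
          ρ (I +⟨ v ⟩)                               ∎)

  -- Evaluate both functions on an independent subspace of `X` whose `ρ`-rank is that of `X`.
  rank-≤ : {ρ ρ′ : RankFunction n} → IsQMatroid ρ → IsQMatroid ρ′ →
           (∀ X → Independent ρ X → Independent ρ′ X) → ∀ X → ρ X ≤ ρ′ X
  rank-≤ {ρ = ρ} {ρ′} ρ-isQMatroid ρ′-isQMatroid ind⇒ind′ X
    with I , I⊑X , ind , ρX≤ρI ← rank-attained ρ-isQMatroid X = begin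
      ρ X    ≤⟨ ρX≤ρI ⟩
      ρ I    ≡⟨ trans ind (sym (ind⇒ind′ I ind)) ⟩
      ρ′ I   ≤⟨ IsQMatroid.monotone ρ′-isQMatroid I X I⊑X ⟩
      ρ′ X   ∎
    where open ≤-Reasoning

  rank-unique : {ρ ρ′ : RankFunction n} → IsQMatroid ρ → IsQMatroid ρ′ →
                (∀ X → Independent ρ X ⇔ Independent ρ′ X) → ∀ X → ρ X ≡ ρ′ X
  rank-unique ρ-isQMatroid ρ′-isQMatroid ind⇔ind′ X = ≤-antisym
    (rank-≤ ρ-isQMatroid ρ′-isQMatroid (Equivalence.to ∘ ind⇔ind′) X)
    (rank-≤ ρ′-isQMatroid ρ-isQMatroid (Equivalence.from ∘ ind⇔ind′) X)

  -- Presentations and Hall's theorem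

  infix 4 _⊑?_

  _⊑?_ : (X Y : Subspace n) → Dec (X ⊑ Y)
  X ⊑? Y with ∃⊎⊑ X Y
  ... | inj₁ (v , v∈X , v∉Y) = no λ X⊑Y → v∉Y (X⊑Y v v∈X)
  ... | inj₂ X⊑Y             = yes X⊑Y

  escapes : Subspace n → Subspace n → ℕ
  escapes A Y with Y ⊑? A
  ... | yes _ = 0
  ... | no  _ = 1

  escapes-≤1 : (A Y : Subspace n) → escapes A Y ≤ 1
  escapes-≤1 A Y with Y ⊑? A
  ... | yes _ = z≤n
  ... | no  _ = ≤-refl

  escapes-⊑ : (A Y : Subspace n) → Y ⊑ A → escapes A Y ≡ 0
  escapes-⊑ A Y Y⊑A with Y ⊑? A
  ... | yes _   = refl
  ... | no  Y⋢A = contradiction Y⊑A Y⋢A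

  escapes-mono : (A X Y : Subspace n) → X ⊑ Y → escapes A X ≤ escapes A Y
  escapes-mono A X Y X⊑Y with Y ⊑? A
  ... | yes Y⊑A = ≤-reflexive (escapes-⊑ A X (⊑-trans {X = X} {Y} {A} X⊑Y Y⊑A))
  ... | no  _   = escapes-≤1 A X

  -- The intersection lies in `A` as soon as one of `X` and `Y` does, and the sum as soon as both
  -- do.
  escapes-submodular : (A X Y : Subspace n) →
                       escapes A (X +ˢ Y) + escapes A (X ∩ Y) ≤ escapes A X + escapes A Y
  escapes-submodular A X Y with X ⊑? A | Y ⊑? A
  ... | yes X⊑A | yes Y⊑A = ≤-reflexive (cong₂ _+_
    (escapes-⊑ A (X +ˢ Y) (+ˢ-least {X = X} {Y} {A} X⊑A Y⊑A))
    (escapes-⊑ A (X ∩ Y) (λ v → X⊑A v ∘ proj₁)))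
  ... | yes X⊑A | no  _   = +-mono-≤ (escapes-≤1 A (X +ˢ Y))
    (≤-reflexive (escapes-⊑ A (X ∩ Y) (λ v → X⊑A v ∘ proj₁)))
  ... | no  _   | yes Y⊑A = +-mono-≤ (escapes-≤1 A (X +ˢ Y))
    (≤-reflexive (escapes-⊑ A (X ∩ Y) (λ v → Y⊑A v ∘ proj₂)))
  ... | no  _   | no  _   = +-mono-≤ (escapes-≤1 A (X +ˢ Y)) (escapes-≤1 A (X ∩ Y))

  -- The size of the neighbourhood of `Y` in Hall's condition: a member of the family that contains
  -- `Y` can be matched with no vector of `Y`.
  avoided : Vec (Subspace n) k → RankFunction n
  avoided []      Y = 0
  avoided (A ∷ 𝒳) Y = escapes A Y + avoided 𝒳 Y

  avoided-isPolymatroid : (𝒳 : Vec (Subspace n) k) → IsPolymatroid (avoided 𝒳)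
  avoided-isPolymatroid []      = record
    { zero-0ˢ    = refl
    ; monotone   = λ _ _ _ → z≤n
    ; submodular = λ _ _ → z≤n
    }
  avoided-isPolymatroid (A ∷ 𝒳) = record
    { zero-0ˢ    = cong₂ _+_ (escapes-⊑ A 0ˢ (0ˢ⊑X A)) zero-0ˢ
    ; monotone   = λ X Y X⊑Y → +-mono-≤ (escapes-mono A X Y X⊑Y) (monotone X Y X⊑Y)
    ; submodular = λ X Y → subst₂ _≤_
        (interchange (escapes A (X +ˢ Y)) _ _ _) (interchange (escapes A X) _ _ _)
        (+-mono-≤ (escapes-submodular A X Y) (submodular X Y))
    }
    where open IsPolymatroid (avoided-isPolymatroid 𝒳)

  escaped : Vec (Subspace n) k → Subspace n → Subset k
  escaped 𝒳 Y = Vec.map (λ A → not (does (Y ⊑? A))) 𝒳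

  ∣escaped∣ : (𝒳 : Vec (Subspace n) k) (Y : Subspace n) → ∣ escaped 𝒳 Y ∣ ≡ avoided 𝒳 Y
  ∣escaped∣ []      Y = refl
  ∣escaped∣ (A ∷ 𝒳) Y with Y ⊑? A
  ... | yes _ = ∣escaped∣ 𝒳 Y
  ... | no  _ = cong suc (∣escaped∣ 𝒳 Y)

  ⋢⇒∈-escaped : (𝒳 : Vec (Subspace n) k) (Y : Subspace n) (i : Fin k) →
                ¬ Y ⊑ lookup 𝒳 i → i ∈ᵖ escaped 𝒳 Y
  ⋢⇒∈-escaped 𝒳 Y i Y⋢A = lookup⇒[]= i (escaped 𝒳 Y)
    (trans (lookup-map i _ 𝒳) (cong not (dec-false (Y ⊑? lookup 𝒳 i) Y⋢A)))

  lookup∈span : (vs : Vec (Vector n) k) (i : Fin k) → lookup vs i ∈ span vs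
  lookup∈span (v ∷ vs) zero    = span-head v vs
  lookup∈span (v ∷ vs) (suc i) = span-tail v vs _ (lookup∈span vs i)

  extend-basis : (X Y : Subspace n) → Y ⊑ X → ∃₂ λ m (us : Vec (Vector n) m) → IsBasis X (us ++ basis Y)
  extend-basis {n} X Y Y⊑X = subspace-induction P
    (λ Z Z′ (Z⊑Z′ , Z′⊑Z) (m , us , li , sp , ps) →
      m , us , li , (λ v → Z⊑Z′ v ∘ sp v) , (λ v → ps v ∘ Z′⊑Z v))
    {Y} {X} Y⊑X (0 , [] , basis-isBasis Y)
    (λ Z v _ _ _ v∉Z (m , us , isBasis) → suc m , v ∷ us , ∷-isBasis {X = Z} v∉Z isBasis)
    where
    P : Subspace n → Set
    P Z = ∃₂ λ m (us : Vec (Vector n) m) → IsBasis Z (us ++ basis Y)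

  -- The easy half of Hall's theorem. Extend a basis of `Y` to one of `X`; a transversal gives the
  -- basis vectors of `Y` distinct members of the family, and each of these misses a vector of `Y`.
  partialQTransversal⇒dim≤avoided : (𝒳 : Vec (Subspace n) k) (X : Subspace n) →
    IsPartialQTransversal 𝒳 X → ∀ Y → Y ⊑ X → dim Y ≤ avoided 𝒳 Y
  partialQTransversal⇒dim≤avoided {n} {k} 𝒳 X transversal Y Y⊑X
    with m , us , isBasis ← extend-basis X Y Y⊑X
    with l≤k , σ , τ , avoids ← transversal (us ++ basis Y) isBasis =
      subst (dim Y ≤_) (∣escaped∣ 𝒳 Y)
        (injective⇒≤∣p∣ {φ = φ} φ-injective (λ j → ⋢⇒∈-escaped 𝒳 Y (φ j) (Y⋢ j)))
    where
    φ : Fin (dim Y) → Fin k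
    -- The basis of `Y` follows the `m` added vectors. The inverse of `σ` finds the place of a
    -- vector in the ordering, and `τ` the member at that place.
    φ j = τ ⟨$⟩ʳ inject≤ (σ ⟨$⟩ˡ (m ↑ʳ j)) l≤k

    φ-injective : Injective _≡_ _≡_ φ
    φ-injective = Fin.↑ʳ-injective m _ _ ∘ Injection.injective (↔⇒↣ (↔-sym σ))
                ∘ Fin.inject≤-injective l≤k l≤k _ _ ∘ Injection.injective (↔⇒↣ τ)

    Y⋢ : ∀ j → ¬ Y ⊑ lookup 𝒳 (φ j)
    Y⋢ j Y⊑A = avoids (σ ⟨$⟩ˡ (m ↑ʳ j)) (subst (_∈ lookup 𝒳 (φ j))
      (sym (trans (cong (lookup (us ++ basis Y)) (Perm.inverseʳ σ)) (lookup-++ʳ us (basis Y) j)))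
      (Y⊑A _ (proj₁ (proj₂ (basis-isBasis Y)) _ (lookup∈span (basis Y) j))))

  -- Avoidance transversals in recursive form, without permutations: the members of the family are
  -- visited in order, and each is dropped or takes a vector. Since `done` needs both lists empty,
  -- every vector gets a member.
  data Matching {n} : ∀ {k l} → Vec (Subspace n) k → Vec (Vector n) l → Set₁ where
    done : Matching [] []
    skip : {xs : Vec (Vector n) l} → Matching 𝒳 xs → Matching (A ∷ 𝒳) xs
    use  : {xs : Vec (Vector n) (suc l)} (p : Fin (suc l)) → lookup xs p ∉ A →
           Matching 𝒳 (removeAt xs p) → Matching (A ∷ 𝒳) xs

  matching⇒transversal : {xs : Vec (Vector n) l} → Matching 𝒳 xs →
                         HasAvoidanceTransversal (Member ∘ lookup 𝒳) xs
  matching⇒transversal done = z≤n , Perm.id , Perm.id , λ ()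
  matching⇒transversal {𝒳 = A ∷ 𝒳} {xs} (skip matching)
    with l≤k , σ , τ , avoids ← matching⇒transversal matching =
      -- The dropped member goes to position `l`, the first that the transversal does not reach.
      m≤n⇒m≤1+n l≤k , σ , insert (fromℕ< (s≤s l≤k)) zero τ , λ i →
        subst (λ j → lookup xs (σ ⟨$⟩ʳ i) ∉ lookup (A ∷ 𝒳) j)
          (trans (sym (insert-punchIn (fromℕ< (s≤s l≤k)) zero τ (inject≤ i l≤k)))
            (cong (insert (fromℕ< (s≤s l≤k)) zero τ ⟨$⟩ʳ_) (punchIn-inject≤ i l≤k)))
          (avoids i)
  matching⇒transversal {𝒳 = A ∷ 𝒳} {xs} (use p x∉A matching)
    with l≤k , σ , τ , avoids ← matching⇒transversal matching =
      -- The new pair comes first in both orderings.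
      s≤s l≤k , insert zero p σ , lift₀ τ , λ where
        zero    → x∉A
        (suc i) → subst (_∉ lookup 𝒳 (τ ⟨$⟩ʳ inject≤ i l≤k))
          (trans (lookup-removeAt xs p (σ ⟨$⟩ʳ i)) (cong (lookup xs) (sym (insert-punchIn zero p σ i))))
          (avoids i)

  lincomb-insertAt : (ds : Vec Carrier l) (xs : Vec (Vector n) (suc l)) (p : Fin (suc l)) →
                     lincomb (insertAt ds p 0#) xs ≡ lincomb ds (removeAt xs p)
  lincomb-insertAt ds       (x ∷ xs)         zero    =
    trans (cong (_+ᵛ lincomb ds xs) (·-zeroˡ x)) (+ᵛ-identityˡ _)
  lincomb-insertAt (d ∷ ds) (x ∷ xs@(_ ∷ _)) (suc p) =
    cong (d · x +ᵛ_) (lincomb-insertAt ds xs p)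

  -- If all terms were in `A`, so would be their sum. The nonzero coefficient is recorded because
  -- removing the vector at `p` is to expel the combination from the span.
  lincomb-∉ : (A : Subspace n) (cs : Vec Carrier l) (xs : Vec (Vector n) l) → lincomb cs xs ∉ A →
              ∃ λ p → lookup cs p ≢ 0# × lookup xs p ∉ A
  lincomb-∉ A []       []       lc∉A = contradiction (0-closed A) lc∉A
  lincomb-∉ A (c ∷ cs) (x ∷ xs) lc∉A with member? A (c · x)
  ... | no  cx∉A = zero ,
    (λ { refl → cx∉A (subst (_∈ A) (sym (·-zeroˡ x)) (0-closed A)) }) , cx∉A ∘ ·-closed A c
  ... | yes cx∈A with p , c≢0 , x∉A ← lincomb-∉ A cs xs (lc∉A ∘ +-closed A cx∈A) = suc p , c≢0 , x∉A

  module _ {xs : Vec (Vector n) (suc l)} (p : Fin (suc l)) where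

    removeAt-independent : LinearlyIndependent xs → LinearlyIndependent (removeAt xs p)
    removeAt-independent li ds eq = begin
      ds                             ≡⟨ removeAt-insertAt ds p 0# ⟨
      removeAt (insertAt ds p 0#) p  ≡⟨ cong (λ es → removeAt es p)
                                          (lincomb-injective li (insertAt ds p 0#) (insertAt 0ᵛ p 0#) same) ⟩
      removeAt (insertAt 0ᵛ p 0#) p  ≡⟨ removeAt-insertAt 0ᵛ p 0# ⟩
      0ᵛ                             ∎
      where
      open ≡-Reasoning
      same : lincomb (insertAt ds p 0#) xs ≡ lincomb (insertAt 0ᵛ p 0#) xs
      same = trans (trans (lincomb-insertAt ds xs p) eq)
        (sym (trans (lincomb-insertAt 0ᵛ xs p) (lincomb-0 (removeAt xs p))))

    removeAt-⊑ : span (removeAt xs p) ⊑ span xs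
    removeAt-⊑ _ (ds , refl) = insertAt ds p 0# , lincomb-insertAt ds xs p

    -- Coefficients are unique, and a combination of the remaining vectors has coefficient zero at
    -- `p`.
    ∉-removeAt : LinearlyIndependent xs → (cs : Vec Carrier (suc l)) → lookup cs p ≢ 0# →
                 lincomb cs xs ∉ span (removeAt xs p)
    ∉-removeAt li cs c≢0 (ds , eq) = c≢0 (begin
      lookup cs p                  ≡⟨ cong (λ es → lookup es p) (lincomb-injective li (insertAt ds p 0#) cs
                                        (trans (lincomb-insertAt ds xs p) eq)) ⟨
      lookup (insertAt ds p 0#) p  ≡⟨ insertAt-lookup ds p 0# ⟩
      0#                           ∎)
      where open ≡-Reasoning

  Violator : Vec (Subspace n) k → Subspace n → Set
  Violator 𝒳 Y = avoided 𝒳 Y < dim Y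

  -- A search through the finite list suffices because a violator stays one when replaced by a
  -- subspace with the same members.
  violator? : (𝒳 : Vec (Subspace n) k) (X : Subspace n) →
              (Σ (Subspace n) λ Y → Y ⊑ X × Violator 𝒳 Y) ⊎ (∀ Y → Y ⊑ X → dim Y ≤ avoided 𝒳 Y)
  violator? 𝒳 X with any? (λ Y → avoided 𝒳 Y <? dim Y) (subspacesOf X)
  ... | yes found = inj₁ (Any.lookup found , All.lookupAny (subspacesOf-sound X) found)
  ... | no  none = inj₂ λ Y Y⊑X → ≮⇒≥ λ violates → none (Any.map (λ {Z} (Z⊑Y , Y⊑Z) →
    <-≤-trans (≤-<-trans (IsPolymatroid.monotone (avoided-isPolymatroid 𝒳) Z Y Z⊑Y) violates)
              (dim-mono Y Z Y⊑Z))
    (subspacesOf-complete X Y Y⊑X))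

  -- Hall's condition at `Y` holds with `A` and fails without it, so `A` must be one of the members
  -- counted.
  violator⇒∃∉ : (A : Subspace n) (𝒳 : Vec (Subspace n) k) {Y : Subspace n} →
                dim Y ≤ avoided (A ∷ 𝒳) Y → Violator 𝒳 Y → ∃ λ y → y ∈ Y × y ∉ A
  violator⇒∃∉ A 𝒳 {Y} dim≤ violates = fromInj₁
    (λ Y⊑A → contradiction
      (subst (λ e → dim Y ≤ e + avoided 𝒳 Y) (escapes-⊑ A Y Y⊑A) dim≤) (<⇒≱ violates))
    (∃⊎⊑ Y A)

  -- The deficiency `dim − avoided 𝒳` is supermodular. It is at least one at `Y` and at `Z`, and at
  -- most one at `Y +ˢ Z`, because the single member `A` repairs it there; so at least one is left
  -- for `Y ∩ Z`.
  violator-∩ : (A : Subspace n) (𝒳 : Vec (Subspace n) k) (Y Z : Subspace n) →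
               dim (Y +ˢ Z) ≤ avoided (A ∷ 𝒳) (Y +ˢ Z) →
               Violator 𝒳 Y → Violator 𝒳 Z → Violator 𝒳 (Y ∩ Z)
  violator-∩ A 𝒳 Y Z dim≤ Y-violates Z-violates = +-cancelˡ-≤ (suc (avoided 𝒳 (Y +ˢ Z))) _ _ (begin
    suc (avoided 𝒳 (Y +ˢ Z)) + suc (avoided 𝒳 (Y ∩ Z))
      ≡⟨ +-suc (suc (avoided 𝒳 (Y +ˢ Z))) _ ⟩
    2 + (avoided 𝒳 (Y +ˢ Z) + avoided 𝒳 (Y ∩ Z))
      ≤⟨ +-monoʳ-≤ 2 (IsPolymatroid.submodular (avoided-isPolymatroid 𝒳) Y Z) ⟩
    2 + (avoided 𝒳 Y + avoided 𝒳 Z)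
      ≡⟨ +-suc (suc (avoided 𝒳 Y)) _ ⟨
    suc (avoided 𝒳 Y) + suc (avoided 𝒳 Z)
      ≤⟨ +-mono-≤ Y-violates Z-violates ⟩
    dim Y + dim Z
      ≡⟨ dim-modular Y Z ⟨
    dim (Y +ˢ Z) + dim (Y ∩ Z)
      ≤⟨ +-monoˡ-≤ (dim (Y ∩ Z)) (≤-trans dim≤ (+-monoˡ-≤ _ (escapes-≤1 A (Y +ˢ Z)))) ⟩
    suc (avoided 𝒳 (Y +ˢ Z)) + dim (Y ∩ Z) ∎)
    where open ≤-Reasoning

  -- Hall's theorem in the subspace lattice.  If A cannot be discarded, some Y
  -- violates the condition for 𝒳, hence Y ⋢ A; match A with a basis vector x ∉ A
  -- that occurs in an element of Y outside A.  If the remaining basis vectors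
  -- span another violator, then its intersection with Y is a smaller violator,
  -- with which the choice is repeated.
  matching : (𝒳 : Vec (Subspace n) k) (xs : Vec (Vector n) l) → LinearlyIndependent xs →
             (∀ Y → Y ⊑ span xs → dim Y ≤ avoided 𝒳 Y) → Matching 𝒳 xs
  matching []      []         _  _    = done
  matching []      xs@(_ ∷ _) li hall = contradiction
    (subst (_≤ 0) (dim-span xs li) (hall (span xs) (⊑-refl {X = span xs}))) λ ()
  matching {n} {l = l} (A ∷ 𝒳) xs li hall with violator? 𝒳 (span xs)
  ... | inj₂ hall′               = skip (matching 𝒳 xs li hall′)
  ... | inj₁ (Y , Y⊑xs , violates) = descend xs li hall (dim Y) Y ≤-refl Y⊑xs violates
    where
    -- The bound `d` on `dim Y` makes the recursion terminate: it drops by one with each passage to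
    -- a smaller violator.
    descend : ∀ {l} (xs : Vec (Vector n) l) → LinearlyIndependent xs →
              (∀ Y → Y ⊑ span xs → dim Y ≤ avoided (A ∷ 𝒳) Y) →
              ∀ d Y → dim Y ≤ d → Y ⊑ span xs → Violator 𝒳 Y → Matching (A ∷ 𝒳) xs
    descend xs li hall d Y dim≤d Y⊑xs violates
      with y , y∈Y , y∉A ← violator⇒∃∉ A 𝒳 {Y} (hall Y Y⊑xs) violates
      with cs , refl ← Y⊑xs y y∈Y
      with p , c≢0 , x∉A ← lincomb-∉ A cs xs y∉A = remove xs li hall d dim≤d Y⊑xs cs p c≢0 x∉A y∈Y
      where
      remove : ∀ {l} (xs : Vec (Vector n) l) → LinearlyIndependent xs →
               (∀ Y → Y ⊑ span xs → dim Y ≤ avoided (A ∷ 𝒳) Y) →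
               ∀ d → dim Y ≤ d → Y ⊑ span xs → (cs : Vec Carrier l) (p : Fin l) →
               lookup cs p ≢ 0# → lookup xs p ∉ A → lincomb cs xs ∈ Y → Matching (A ∷ 𝒳) xs
      remove {suc l} xs li hall d dim≤d Y⊑xs cs p c≢0 x∉A y∈Y with violator? 𝒳 (span (removeAt xs p))
      ... | inj₂ hall′ = use p x∉A (matching 𝒳 (removeAt xs p) (removeAt-independent p li) hall′)
      ... | inj₁ (Z , Z⊑ , Z-violates) = shrink d dim≤d
        where
        -- The combination `lincomb cs xs` separates the two: it is in `Y`, but it involves the
        -- removed vector and so is not in `Z`.
        dim∩<dim : dim (Y ∩ Z) < dim Y
        dim∩<dim = dim-< {X = Y ∩ Z} {Y} (X∩Y⊑X Y Z) y∈Y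
          (λ (_ , y∈Z) → ∉-removeAt p li cs c≢0 (Z⊑ _ y∈Z))

        shrink : ∀ d → dim Y ≤ d → Matching (A ∷ 𝒳) xs
        shrink zero    dim≤0 = contradiction (<-≤-trans dim∩<dim dim≤0) λ ()
        shrink (suc d) dim≤d = descend xs li hall d (Y ∩ Z) (≤-pred (≤-trans dim∩<dim dim≤d))
          (λ v → Y⊑xs v ∘ proj₁)
          (violator-∩ A 𝒳 Y Z (hall (Y +ˢ Z)
            (+ˢ-least {X = Y} {Z} {span xs} Y⊑xs (λ v → removeAt-⊑ p v ∘ Z⊑ v))) violates Z-violates)

  partialQTransversal⇔dim≤avoided : (𝒳 : Vec (Subspace n) k) (X : Subspace n) →
    IsPartialQTransversal 𝒳 X ⇔ (∀ Y → Y ⊑ X → dim Y ≤ avoided 𝒳 Y)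
  partialQTransversal⇔dim≤avoided 𝒳 X = mk⇔ (partialQTransversal⇒dim≤avoided 𝒳 X)
    λ hall xs (li , xs⊑X , _) →
      matching⇒transversal (matching 𝒳 xs li (λ Y Y⊑xs → hall Y (λ v → xs⊑X v ∘ Y⊑xs v)))

  independent⇔partialQTransversal : (𝒳 : Vec (Subspace n) k) (X : Subspace n) →
    Independent (induced (avoided 𝒳)) X ⇔ IsPartialQTransversal 𝒳 X
  independent⇔partialQTransversal 𝒳 X =
    ⇔-sym (partialQTransversal⇔dim≤avoided 𝒳 X) ⇔-∘ induced-independent (avoided-isPolymatroid 𝒳) X

  transversal-rank : {ρ : RankFunction n} {𝒳 : Vec (Subspace n) k} → IsTransversalQMatroid ρ 𝒳 →
                     ∀ X → ρ X ≡ induced (avoided 𝒳) X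
  transversal-rank {𝒳 = 𝒳} ρ-transversal = rank-unique isQMatroid
    (induced-isQMatroid (avoided-isPolymatroid 𝒳))
    (λ X → ⇔-sym (independent⇔partialQTransversal 𝒳 X) ⇔-∘ independent X)
    where open IsTransversalQMatroid ρ-transversal

  -- Direct sums

  qMatroid⇒polymatroid : {ρ : RankFunction n} → IsQMatroid ρ → IsPolymatroid ρ
  qMatroid⇒polymatroid {n} ρ-isQMatroid = record
    { zero-0ˢ    = n≤0⇒n≡0 (≤-trans (bounded 0ˢ) (≤-reflexive (dim-0ˢ n)))
    ; monotone   = monotone
    ; submodular = submodular
    }
    where open IsQMatroid ρ-isQMatroid

  -- The image of a sum lies in the sum of the images and the image of an intersection in the
  -- intersection of the images; monotonicity of `f` then reduces submodularity to that of `f`.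
  image-isPolymatroid : {f : RankFunction n} → IsPolymatroid f → (g : Vector m → Vector n)
    (g-+ : ∀ v w → g (v +ᵛ w) ≡ g v +ᵛ g w) (g-· : ∀ c v → g (c · v) ≡ c · g v) →
    IsPolymatroid (f ∘ image g g-+ g-·)
  image-isPolymatroid {f = f} f-isPolymatroid g g-+ g-· = record
    { zero-0ˢ    = n≤0⇒n≡0 (≤-trans
        (monotone (im 0ˢ) 0ˢ λ { _ (_ , ([] , refl) , refl) → subst (_∈ 0ˢ) (sym g-0) (0-closed 0ˢ) })
        (≤-reflexive zero-0ˢ))
    ; monotone   = λ X Y X⊑Y → monotone (im X) (im Y) λ _ (v , v∈X , eq) → v , X⊑Y v v∈X , eq
    ; submodular = λ X Y → ≤-trans
        (+-mono-≤
          (monotone (im (X +ˢ Y)) (im X +ˢ im Y) λ { _ (_ , (x , y , x∈ , y∈ , refl) , refl) →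
            g x , g y , (x , x∈ , refl) , (y , y∈ , refl) , sym (g-+ x y) })
          (monotone (im (X ∩ Y)) (im X ∩ im Y) λ _ (v , (v∈X , v∈Y) , eq) → (v , v∈X , eq) , (v , v∈Y , eq)))
        (submodular (im X) (im Y))
    }
    where
    open IsPolymatroid f-isPolymatroid
    im = image g g-+ g-·
    g-0 : g 0ᵛ ≡ 0ᵛ
    g-0 = trans (cong g (sym (·-zeroˡ 0ᵛ))) (trans (g-· 0# 0ᵛ) (·-zeroˡ (g 0ᵛ)))

  +-isPolymatroid : {f g : RankFunction n} → IsPolymatroid f → IsPolymatroid g →
                    IsPolymatroid (λ X → f X + g X)
  +-isPolymatroid {f = f} {g} f-isPolymatroid g-isPolymatroid = record
    { zero-0ˢ    = cong₂ _+_ F.zero-0ˢ G.zero-0ˢ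
    ; monotone   = λ X Y X⊑Y → +-mono-≤ (F.monotone X Y X⊑Y) (G.monotone X Y X⊑Y)
    ; submodular = λ X Y → subst₂ _≤_ (interchange (f (X +ˢ Y)) _ _ _) (interchange (f X) _ _ _)
        (+-mono-≤ (F.submodular X Y) (G.submodular X Y))
    }
    where
    module F = IsPolymatroid f-isPolymatroid
    module G = IsPolymatroid g-isPolymatroid

  infixr 5 _⊞_

  _⊞_ : RankFunction n₁ → RankFunction n₂ → RankFunction (n₁ + n₂)
  _⊞_ {n₁} f₁ f₂ X = f₁ (π₁ n₁ X) + f₂ (π₂ n₁ X)

  ⊞-isPolymatroid : {f₁ : RankFunction n₁} {f₂ : RankFunction n₂} →
                    IsPolymatroid f₁ → IsPolymatroid f₂ → IsPolymatroid (f₁ ⊞ f₂)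
  ⊞-isPolymatroid {n₁} f₁-isPolymatroid f₂-isPolymatroid = +-isPolymatroid
    (image-isPolymatroid f₁-isPolymatroid (take n₁) _ _)
    (image-isPolymatroid f₂-isPolymatroid (drop n₁) _ _)

  X⊑π₁⊕π₂ : (X : Subspace (n₁ + n₂)) → X ⊑ (π₁ n₁ X ⊕ π₂ n₁ X)
  X⊑π₁⊕π₂ X v v∈X = (v , v∈X , refl) , (v , v∈X , refl)

  escapes-cong : (A Y : Subspace m) (B Z : Subspace n) → (Y ⊑ A → Z ⊑ B) → (Z ⊑ B → Y ⊑ A) →
                 escapes A Y ≡ escapes B Z
  escapes-cong A Y B Z ⇒ ⇐ with Y ⊑? A | Z ⊑? B
  ... | yes _   | yes _   = refl
  ... | yes Y⊑A | no  Z⋢B = contradiction (⇒ Y⊑A) Z⋢B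
  ... | no  Y⋢A | yes Z⊑B = contradiction (⇐ Z⊑B) Y⋢A
  ... | no  _   | no  _   = refl

  avoided-++ : (𝒳 : Vec (Subspace n) k) (𝒴 : Vec (Subspace n) l) (Y : Subspace n) →
               avoided (𝒳 ++ 𝒴) Y ≡ avoided 𝒳 Y + avoided 𝒴 Y
  avoided-++ []      𝒴 Y = refl
  avoided-++ (A ∷ 𝒳) 𝒴 Y = trans (cong (escapes A Y +_) (avoided-++ 𝒳 𝒴 Y)) (sym (+-assoc (escapes A Y) _ _))

  -- `Y` lies in `A ⊕ full` exactly when its first projection lies in `A`.
  avoided-⊕full : (𝒳 : Vec (Subspace n₁) k) (Y : Subspace (n₁ + n₂)) →
                  avoided (Vec.map (_⊕ full) 𝒳) Y ≡ avoided 𝒳 (π₁ n₁ Y)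
  avoided-⊕full []      Y = refl
  avoided-⊕full {n₁} (A ∷ 𝒳) Y = cong₂ _+_
    (escapes-cong (A ⊕ full) Y A (π₁ n₁ Y)
      (λ { Y⊑ _ (v , v∈Y , refl) → proj₁ (Y⊑ v v∈Y) })
      (λ π₁Y⊑A v v∈Y → π₁Y⊑A _ (v , v∈Y , refl) , _))
    (avoided-⊕full 𝒳 Y)

  avoided-full⊕ : (𝒳 : Vec (Subspace n₂) k) (Y : Subspace (n₁ + n₂)) →
                  avoided (Vec.map (full ⊕_) 𝒳) Y ≡ avoided 𝒳 (π₂ n₁ Y)
  avoided-full⊕           []      Y = refl
  avoided-full⊕ {n₁ = n₁} (A ∷ 𝒳) Y = cong₂ _+_
    (escapes-cong (full ⊕ A) Y A (π₂ n₁ Y)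
      (λ { Y⊑ _ (v , v∈Y , refl) → proj₂ (Y⊑ v v∈Y) })
      (λ π₂Y⊑A v v∈Y → _ , π₂Y⊑A _ (v , v∈Y , refl)))
    (avoided-full⊕ 𝒳 Y)

  avoided-⊕ᵖ : (𝒳₁ : Vec (Subspace n₁) k) (𝒳₂ : Vec (Subspace n₂) l) (Y : Subspace (n₁ + n₂)) →
               avoided (𝒳₁ ⊕ᵖ 𝒳₂) Y ≡ (avoided 𝒳₁ ⊞ avoided 𝒳₂) Y
  avoided-⊕ᵖ 𝒳₁ 𝒳₂ Y = trans (avoided-++ (Vec.map (_⊕ full) 𝒳₁) _ Y)
    (cong₂ _+_ (avoided-⊕full 𝒳₁ Y) (avoided-full⊕ 𝒳₂ Y))

  -- Apply the dimension formula to `X` and `W₁ ⊕ W₂`, with `W₁` and `W₂` attaining the two minima.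
  -- The sum stays inside the direct sum of the projections of `X`, and the hypothesis bounds the
  -- intersection by `f₁ W₁ + f₂ W₂`.
  ⊞-induced : {f₁ : RankFunction n₁} {f₂ : RankFunction n₂} → IsPolymatroid f₁ → IsPolymatroid f₂ →
              (X : Subspace (n₁ + n₂)) → (∀ Y → Y ⊑ X → dim Y ≤ (f₁ ⊞ f₂) Y) →
              dim X ≤ (induced f₁ ⊞ induced f₂) X
  ⊞-induced {n₁} {f₁ = f₁} {f₂} f₁-isPolymatroid f₂-isPolymatroid X dim≤ =
    let W₁ , W₁⊑ , attained₁ = induced-attained f₁ (π₁ n₁ X)
        W₂ , W₂⊑ , attained₂ = induced-attained f₂ (π₂ n₁ X)
        W = W₁ ⊕ W₂
    in +-cancelʳ-≤ (dim W₁ + dim W₂) _ _ (begin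
      dim X + (dim W₁ + dim W₂)
        ≡⟨ cong (dim X +_) (dim-⊕ W₁ W₂) ⟨
      dim X + dim W
        ≡⟨ dim-modular X W ⟨
      dim (X +ˢ W) + dim (X ∩ W)
        ≤⟨ +-mono-≤
             (dim-mono (X +ˢ W) (π₁ n₁ X ⊕ π₂ n₁ X)
               (+ˢ-least {X = X} {W} {π₁ n₁ X ⊕ π₂ n₁ X} (X⊑π₁⊕π₂ X)
               (λ _ (v₁∈ , v₂∈) → W₁⊑ _ v₁∈ , W₂⊑ _ v₂∈)))
             (≤-trans (dim≤ (X ∩ W) (X∩Y⊑X X W))
               (+-mono-≤ (IsPolymatroid.monotone f₁-isPolymatroid (π₁ n₁ (X ∩ W)) W₁
                 (λ { _ (_ , (_ , v₁∈ , _) , refl) → v₁∈ }))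
                         (IsPolymatroid.monotone f₂-isPolymatroid (π₂ n₁ (X ∩ W)) W₂
                 (λ { _ (_ , (_ , _ , v₂∈) , refl) → v₂∈ })))) ⟩
      dim (π₁ n₁ X ⊕ π₂ n₁ X) + (f₁ W₁ + f₂ W₂)
        ≡⟨ trans (+-comm _ (f₁ W₁ + f₂ W₂)) (cong (f₁ W₁ + f₂ W₂ +_) (dim-⊕ (π₁ n₁ X) (π₂ n₁ X))) ⟩
      (f₁ W₁ + f₂ W₂) + (dim (π₁ n₁ X) + dim (π₂ n₁ X))
        ≡⟨ interchange (f₁ W₁) _ _ _ ⟩
      (f₁ W₁ + dim (π₁ n₁ X)) + (f₂ W₂ + dim (π₂ n₁ X))
        ≡⟨ cong₂ _+_ attained₁ attained₂ ⟨
      (induced f₁ (π₁ n₁ X) + dim W₁) + (induced f₂ (π₂ n₁ X) + dim W₂)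
        ≡⟨ interchange (induced f₁ (π₁ n₁ X)) _ _ _ ⟩
      (induced f₁ (π₁ n₁ X) + induced f₂ (π₂ n₁ X)) + (dim W₁ + dim W₂) ∎)
    where open ≤-Reasoning

  module _ {ρ₁ : RankFunction n₁} {ρ₂ : RankFunction n₂}
           (ρ₁-isQMatroid : IsQMatroid ρ₁) (ρ₂-isQMatroid : IsQMatroid ρ₂) where

    ⊕ʳ-isPolymatroid : IsPolymatroid (ρ₁ ⊞ ρ₂)
    ⊕ʳ-isPolymatroid = ⊞-isPolymatroid (qMatroid⇒polymatroid ρ₁-isQMatroid) (qMatroid⇒polymatroid ρ₂-isQMatroid)

    -- ρ₁ ⊕ʳ ρ₂ unfolds to induced (ρ₁ ⊞ ρ₂).
    ⊕ʳ-isQMatroid : IsQMatroid (ρ₁ ⊕ʳ ρ₂)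
    ⊕ʳ-isQMatroid = induced-isQMatroid ⊕ʳ-isPolymatroid

  ⊕ʳ-isTransversal : {ρ₁ : RankFunction n₁} {ρ₂ : RankFunction n₂}
    {𝒳₁ : Vec (Subspace n₁) k} {𝒳₂ : Vec (Subspace n₂) l} →
    IsTransversalQMatroid ρ₁ 𝒳₁ → IsTransversalQMatroid ρ₂ 𝒳₂ →
    IsTransversalQMatroid (ρ₁ ⊕ʳ ρ₂) (𝒳₁ ⊕ᵖ 𝒳₂)
  ⊕ʳ-isTransversal {n₁} {ρ₁ = ρ₁} {ρ₂} {𝒳₁} {𝒳₂} transversal₁ transversal₂ = record
    { isQMatroid  = ⊕ʳ-isQMatroid M₁.isQMatroid M₂.isQMatroid
    ; independent = λ X →
        ⇔-sym (partialQTransversal⇔dim≤avoided (𝒳₁ ⊕ᵖ 𝒳₂) X)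
          ⇔-∘ (mk⇔ (ranks⇒avoided X) (avoided⇒ranks X)
            ⇔-∘ induced-independent (⊕ʳ-isPolymatroid M₁.isQMatroid M₂.isQMatroid) X)
    }
    where
    module M₁ = IsTransversalQMatroid transversal₁
    module M₂ = IsTransversalQMatroid transversal₂
    open ≤-Reasoning

    ρ≡induced : ∀ Y → (ρ₁ ⊞ ρ₂) Y ≡ (induced (avoided 𝒳₁) ⊞ induced (avoided 𝒳₂)) Y
    ρ≡induced Y = cong₂ _+_ (transversal-rank transversal₁ (π₁ n₁ Y)) (transversal-rank transversal₂ (π₂ n₁ Y))

    ranks⇒avoided : ∀ X → (∀ Y → Y ⊑ X → dim Y ≤ (ρ₁ ⊞ ρ₂) Y) → ∀ Y → Y ⊑ X → dim Y ≤ avoided (𝒳₁ ⊕ᵖ 𝒳₂) Y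
    ranks⇒avoided X dim≤ Y Y⊑X = begin
      dim Y                                               ≤⟨ dim≤ Y Y⊑X ⟩
      (ρ₁ ⊞ ρ₂) Y                                         ≡⟨ ρ≡induced Y ⟩
      (induced (avoided 𝒳₁) ⊞ induced (avoided 𝒳₂)) Y     ≤⟨ +-mono-≤ (induced-≤ (avoided-isPolymatroid 𝒳₁) (π₁ n₁ Y))
                                                                      (induced-≤ (avoided-isPolymatroid 𝒳₂) (π₂ n₁ Y)) ⟩
      (avoided 𝒳₁ ⊞ avoided 𝒳₂) Y                         ≡⟨ avoided-⊕ᵖ 𝒳₁ 𝒳₂ Y ⟨
      avoided (𝒳₁ ⊕ᵖ 𝒳₂) Y                                ∎

    avoided⇒ranks : ∀ X → (∀ Y → Y ⊑ X → dim Y ≤ avoided (𝒳₁ ⊕ᵖ 𝒳₂) Y) → ∀ Y → Y ⊑ X → dim Y ≤ (ρ₁ ⊞ ρ₂) Y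
    avoided⇒ranks X dim≤ Y Y⊑X = begin
      dim Y                                               ≤⟨ ⊞-induced
                                                               (avoided-isPolymatroid 𝒳₁) (avoided-isPolymatroid 𝒳₂) Y
                                                               (λ Z Z⊑Y → ≤-trans (dim≤ Z (λ v → Y⊑X v ∘ Z⊑Y v))
                                                                            (≤-reflexive (avoided-⊕ᵖ 𝒳₁ 𝒳₂ Z))) ⟩
      (induced (avoided 𝒳₁) ⊞ induced (avoided 𝒳₂)) Y     ≡⟨ ρ≡induced Y ⟨
      (ρ₁ ⊞ ρ₂) Y                                         ∎

  -- Cyclic flats

  -- When `X` is built up from `Y` one vector at a time, the last space before `X` is such a
  -- hyperplane.
  hyperplane-⊒ : {X Y : Subspace n} {v : Vector n} → Y ⊑ X → v ∈ X → v ∉ Y →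
                 Σ (Subspace n) λ H → Y ⊑ H × H ⊑ X × suc (dim H) ≡ dim X
  hyperplane-⊒ {n} {X} {Y} {v} Y⊑X v∈X v∉Y =
    fromInj₂ (λ X⊑Y → contradiction (X⊑Y v v∈X) v∉Y)
      (subspace-induction P P-resp {Y} {X} Y⊑X (inj₁ (⊑-refl {X = Y}))
        (λ Z w Y⊑Z _ _ w∉Z _ → inj₂ (Z , Y⊑Z , X⊑X+⟨v⟩ Z w , sym (dim-+⟨⟩ {X = Z} w∉Z))))
    where
    P : Subspace n → Set₁
    -- The left alternative serves the start of the chain; at `X` it is excluded by `v`.
    P Z = Z ⊑ Y ⊎ Σ (Subspace n) λ H → Y ⊑ H × H ⊑ Z × suc (dim H) ≡ dim Z

    P-resp : ∀ Z Z′ → Z ≐ Z′ → P Z → P Z′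
    P-resp Z Z′ (_ , Z′⊑Z) (inj₁ Z⊑Y) = inj₁ (λ w → Z⊑Y w ∘ Z′⊑Z w)
    P-resp Z Z′ Z≐Z′@(Z⊑Z′ , _) (inj₂ (H , Y⊑H , H⊑Z , eq)) =
      inj₂ (H , Y⊑H , (λ w → Z⊑Z′ w ∘ H⊑Z w) , trans eq (dim-≐ Z Z′ Z≐Z′))

  -- If the minimum is attained at W ≠ X, then a hyperplane of X above W has smaller
  -- rank than X.
  cyclic⇒induced≡ : {f : RankFunction n} → IsPolymatroid f → (X : Subspace n) →
                    IsCyclic (induced f) X → induced f X ≡ f X
  cyclic⇒induced≡ {n} {f} f-isPolymatroid X cyclic =
    ≤-antisym (induced-≤ f-isPolymatroid X) (+-cancelʳ-≤ (dim X) _ _ (begin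
      f X + dim X          ≤⟨ +-monoˡ-≤ (dim X) (IsPolymatroid.monotone f-isPolymatroid X W X⊑W) ⟩
      f W + dim X          ≡⟨ attained ⟨
      induced f X + dim W  ≤⟨ +-monoʳ-≤ (induced f X) (dim-mono W X W⊑X) ⟩
      induced f X + dim X  ∎))
    where
    open ≤-Reasoning

    W : Subspace n
    W = proj₁ (induced-attained f X)

    W⊑X : W ⊑ X
    W⊑X = proj₁ (proj₂ (induced-attained f X))

    attained : induced f X + dim W ≡ f W + dim X
    attained = proj₂ (proj₂ (induced-attained f X))

    -- `W` also competes for `H`, with a value one below the rank of `X`, whereas cyclicity gives
    -- `H` that same rank.
    hyperplane-impossible : (H : Subspace n) → W ⊑ H → H ⊑ X → suc (dim H) ≢ dim X
    hyperplane-impossible H W⊑H H⊑X eq = <⇒≱ (≤-reflexive eq) (+-cancelˡ-≤ (f W) _ _ (begin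
      f W + dim X          ≡⟨ attained ⟨
      induced f X + dim W  ≡⟨ cong (_+ dim W) (cyclic H H⊑X eq) ⟨
      induced f H + dim W  ≤⟨ induced-least f-isPolymatroid H W W⊑H ⟩
      f W + dim H          ∎))

    X⊑W : X ⊑ W
    X⊑W = fromInj₂ (λ (v , v∈X , v∉W) →
      let H , W⊑H , H⊑X , eq = hyperplane-⊒ {X = X} {W} W⊑X v∈X v∉W
      in contradiction eq (hyperplane-impossible H W⊑H H⊑X))
      (∃⊎⊑ X W)

  module _ {ρ₁ : RankFunction n₁} {ρ₂ : RankFunction n₂}
           (ρ₁-isQMatroid : IsQMatroid ρ₁) (ρ₂-isQMatroid : IsQMatroid ρ₂)
           (X : Subspace (n₁ + n₂)) (cyclicFlat : IsCyclicFlat (ρ₁ ⊕ʳ ρ₂) X) where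

    private
      module M₁ = IsQMatroid ρ₁-isQMatroid
      module M₂ = IsQMatroid ρ₂-isQMatroid
      open IsQMatroid (⊕ʳ-isQMatroid ρ₁-isQMatroid ρ₂-isQMatroid)
      open ≤-Reasoning

      ρ : RankFunction (n₁ + n₂)
      ρ = ρ₁ ⊕ʳ ρ₂

      X₁ : Subspace n₁
      X₁ = π₁ n₁ X

      X₂ : Subspace n₂
      X₂ = π₂ n₁ X

      ρX : ρ X ≡ ρ₁ X₁ + ρ₂ X₂
      ρX = cyclic⇒induced≡ (⊕ʳ-isPolymatroid ρ₁-isQMatroid ρ₂-isQMatroid) X (proj₁ cyclicFlat)

      ρ≤ : (Z : Subspace (n₁ + n₂)) (Z₁ : Subspace n₁) (Z₂ : Subspace n₂) → Z ⊑ (Z₁ ⊕ Z₂) →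
           ρ Z ≤ ρ₁ Z₁ + ρ₂ Z₂
      ρ≤ Z Z₁ Z₂ Z⊑ = ≤-trans (induced-≤ (⊕ʳ-isPolymatroid ρ₁-isQMatroid ρ₂-isQMatroid) Z)
        (+-mono-≤ (M₁.monotone (π₁ n₁ Z) Z₁ λ { _ (v , v∈Z , refl) → proj₁ (Z⊑ v v∈Z) })
                  (M₂.monotone (π₂ n₁ Z) Z₂ λ { _ (v , v∈Z , refl) → proj₂ (Z⊑ v v∈Z) }))

    -- By flatness, adjoining a vector of `X₁ ⊕ X₂` outside `X` would raise the rank; but the
    -- enlarged space still projects into `X₁` and `X₂`, so its rank is at most `ρ₁ X₁ + ρ₂ X₂`,
    -- which is the rank of `X`.
    cyclicFlat-⊕ : X ≐ (X₁ ⊕ X₂)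
    cyclicFlat-⊕ = X⊑π₁⊕π₂ X , fromInj₂ (λ (v , v∈X₁⊕X₂ , v∉X) → contradiction
      (begin-strict
        ρ X             <⟨ proj₂ cyclicFlat v v∉X ⟩
        ρ (X +⟨ v ⟩)    ≤⟨ ρ≤ (X +⟨ v ⟩) X₁ X₂ (+⟨⟩-least {X = X} {X₁ ⊕ X₂} (X⊑π₁⊕π₂ X) v∈X₁⊕X₂) ⟩
        ρ₁ X₁ + ρ₂ X₂   ≡⟨ ρX ⟨
        ρ X             ∎) (<-irrefl refl))
      (∃⊎⊑ (X₁ ⊕ X₂) X)

    -- A hyperplane `H` of `X₁` gives the hyperplane `H ⊕ X₂` of `X`, and a vector outside `X₁`,
    -- padded with zeros, is outside `X`. In both cases the common term `ρ₂ X₂` cancels.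
    cyclicFlat-π₁ : IsCyclicFlat ρ₁ X₁
    cyclicFlat-π₁ = cyclic , flat
      where
      cyclic : IsCyclic ρ₁ X₁
      cyclic H H⊑X₁ eq = ≤-antisym (M₁.monotone H X₁ H⊑X₁) (+-cancelʳ-≤ (ρ₂ X₂) _ _ (begin
        ρ₁ X₁ + ρ₂ X₂  ≡⟨ ρX ⟨
        ρ X            ≡⟨ proj₁ cyclicFlat (H ⊕ X₂)
                            (λ v (v₁∈H , v₂∈X₂) → proj₂ cyclicFlat-⊕ v (H⊑X₁ _ v₁∈H , v₂∈X₂))
                            (≡.begin
                              suc (dim (H ⊕ X₂))    ≡.≡⟨ cong suc (dim-⊕ H X₂) ⟩
                              suc (dim H) + dim X₂  ≡.≡⟨ cong (_+ dim X₂) eq ⟩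
                              dim X₁ + dim X₂       ≡.≡⟨ dim-⊕ X₁ X₂ ⟨
                              dim (X₁ ⊕ X₂)         ≡.≡⟨ dim-≐ X (X₁ ⊕ X₂) cyclicFlat-⊕ ⟨
                              dim X                 ≡.∎) ⟨
        ρ (H ⊕ X₂)     ≤⟨ ρ≤ (H ⊕ X₂) H X₂ (⊑-refl {X = H ⊕ X₂}) ⟩
        ρ₁ H + ρ₂ X₂   ∎))
        where module ≡ = ≡-Reasoning

      flat : IsFlat ρ₁ X₁
      flat v v∉X₁ = +-cancelʳ-< (ρ₂ X₂) _ _ (begin-strict
        ρ₁ X₁ + ρ₂ X₂             ≡⟨ ρX ⟨
        ρ X                       <⟨ proj₂ cyclicFlat u (λ u∈X → v∉X₁ (u , u∈X , proj₁ (take-drop-++ v 0ᵛ))) ⟩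
        ρ (X +⟨ u ⟩)              ≤⟨ ρ≤ (X +⟨ u ⟩) (X₁ +⟨ v ⟩) X₂
                                       (+⟨⟩-least {X = X} {(X₁ +⟨ v ⟩) ⊕ X₂}
                                         (λ w w∈X → X⊑X+⟨v⟩ X₁ v _ (w , w∈X , refl) , (w , w∈X , refl))
                                         (∈-⊕⁺ {X = X₁ +⟨ v ⟩} {X₂} (v∈X+⟨v⟩ X₁ v) (0-closed X₂))) ⟩
        ρ₁ (X₁ +⟨ v ⟩) + ρ₂ X₂    ∎)
        where u = v ++ 0ᵛ

    cyclicFlat-π₂ : IsCyclicFlat ρ₂ X₂
    cyclicFlat-π₂ = cyclic , flat
      where
      cyclic : IsCyclic ρ₂ X₂
      cyclic H H⊑X₂ eq = ≤-antisym (M₂.monotone H X₂ H⊑X₂) (+-cancelˡ-≤ (ρ₁ X₁) _ _ (begin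
        ρ₁ X₁ + ρ₂ X₂  ≡⟨ ρX ⟨
        ρ X            ≡⟨ proj₁ cyclicFlat (X₁ ⊕ H)
                            (λ v (v₁∈X₁ , v₂∈H) → proj₂ cyclicFlat-⊕ v (v₁∈X₁ , H⊑X₂ _ v₂∈H))
                            (≡.begin
                              suc (dim (X₁ ⊕ H))    ≡.≡⟨ cong suc (dim-⊕ X₁ H) ⟩
                              suc (dim X₁ + dim H)  ≡.≡⟨ +-suc (dim X₁) (dim H) ⟨
                              dim X₁ + suc (dim H)  ≡.≡⟨ cong (dim X₁ +_) eq ⟩
                              dim X₁ + dim X₂       ≡.≡⟨ dim-⊕ X₁ X₂ ⟨
                              dim (X₁ ⊕ X₂)         ≡.≡⟨ dim-≐ X (X₁ ⊕ X₂) cyclicFlat-⊕ ⟨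
                              dim X                 ≡.∎) ⟨
        ρ (X₁ ⊕ H)     ≤⟨ ρ≤ (X₁ ⊕ H) X₁ H (⊑-refl {X = X₁ ⊕ H}) ⟩
        ρ₁ X₁ + ρ₂ H   ∎))
        where module ≡ = ≡-Reasoning

      flat : IsFlat ρ₂ X₂
      flat v v∉X₂ = +-cancelˡ-< (ρ₁ X₁) _ _ (begin-strict
        ρ₁ X₁ + ρ₂ X₂             ≡⟨ ρX ⟨
        ρ X                       <⟨ proj₂ cyclicFlat u (λ u∈X → v∉X₂ (u , u∈X , proj₂ (take-drop-++ (0ᵛ {n₁}) v))) ⟩
        ρ (X +⟨ u ⟩)              ≤⟨ ρ≤ (X +⟨ u ⟩) X₁ (X₂ +⟨ v ⟩)
                                       (+⟨⟩-least {X = X} {X₁ ⊕ (X₂ +⟨ v ⟩)}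
                                         (λ w w∈X → (w , w∈X , refl) , X⊑X+⟨v⟩ X₂ v _ (w , w∈X , refl))
                                         (∈-⊕⁺ {X = X₁} {X₂ +⟨ v ⟩} (0-closed X₁) (v∈X+⟨v⟩ X₂ v))) ⟩
        ρ₁ X₁ + ρ₂ (X₂ +⟨ v ⟩)    ∎)
        where u = 0ᵛ ++ v

  -- Coordinate subspaces

  -- The same space as the span of the unit vectors in `S`, but given by vanishing coordinates, a
  -- condition that splits along concatenation.
  coordinateSpace : Subset n → Subspace n
  coordinateSpace S = record
    { Member   = λ v → ∀ i → lookup S i ≡ outside → lookup v i ≡ 0#
    ; member?  = λ v → Fin.all? λ i → (lookup S i Bool.≟ outside) →-dec (lookup v i ≟ᶠ 0#)
    ; 0-closed = λ i _ → lookup-replicate i 0#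
    ; +-closed = λ {v} {w} v∈ w∈ i i∉S → trans (lookup-zipWith _+ᶠ_ i v w)
        (trans (cong₂ _+ᶠ_ (v∈ i i∉S) (w∈ i i∉S)) (K.+-identityˡ 0#))
    ; ·-closed = λ c {v} v∈ i i∉S → trans (lookup-map i (c *ᶠ_) v)
        (trans (cong (c *ᶠ_) (v∈ i i∉S)) (K.zeroʳ c))
    }

  lincomb-∷0 : (cs : Vec Carrier k) (vs : Vec (Vector n) k) →
               lincomb cs (Vec.map (0# ∷_) vs) ≡ 0# ∷ lincomb cs vs
  lincomb-∷0 []       []       = refl
  lincomb-∷0 (c ∷ cs) (v ∷ vs) = trans (cong (c · (0# ∷ v) +ᵛ_) (lincomb-∷0 cs vs))
    (cong (_∷ (c · v +ᵛ lincomb cs vs)) (trans (K.+-identityʳ _) (K.zeroʳ c)))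

  lincomb-units : (v : Vector n) → lincomb v (tabulate unit) ≡ v
  lincomb-units []      = refl
  lincomb-units (x ∷ v) = begin
    x · (1# ∷ 0ᵛ) +ᵛ lincomb v (tabulate (λ i → 0# ∷ unit i))
      ≡⟨ cong (λ us → x · (1# ∷ 0ᵛ) +ᵛ lincomb v us) (tabulate-∘ (0# ∷_) unit) ⟩
    x · (1# ∷ 0ᵛ) +ᵛ lincomb v (Vec.map (0# ∷_) (tabulate unit))
      ≡⟨ cong₂ _+ᵛ_ (cong₂ _∷_ (K.*-identityʳ x) (·-zeroʳ x))
           (trans (lincomb-∷0 v _) (cong (0# ∷_) (lincomb-units v))) ⟩
    (x ∷ 0ᵛ) +ᵛ (0# ∷ v)
      ≡⟨ cong₂ _∷_ (K.+-identityʳ x) (+ᵛ-identityˡ v) ⟩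
    x ∷ v ∎
    where open ≡-Reasoning

  lincomb-∈ : (X : Subspace n) (cs : Vec Carrier k) (vs : Vec (Vector n) k) →
              (∀ i → lookup cs i · lookup vs i ∈ X) → lincomb cs vs ∈ X
  lincomb-∈ X []       []       _     = 0-closed X
  lincomb-∈ X (c ∷ cs) (v ∷ vs) cvs∈X = +-closed X (cvs∈X zero) (lincomb-∈ X cs vs (cvs∈X ∘ suc))

  -- For the harder inclusion, expand `v` in the standard basis: each term is a multiple of a
  -- generator or has coefficient zero.
  span-units : (S : Subset n) →
    span (Vec.fromList (List.map unit (List.filter (Subset._∈? S) (List.allFin n)))) ≐ coordinateSpace S
  span-units {n} S =
    span-⊑ {X = coordinateSpace S} (All.map⁺ (All.map
      (λ {i} i∈S j j∉S → trans
        (lookup∘update′ {i = j} {j = i}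
          (λ { refl → contradiction (trans (sym j∉S) ([]=⇒lookup i∈S)) λ () }) (0ᵛ {n}) 1#)
        (lookup-replicate j 0#))
      (All.all-filter (Subset._∈? S) (List.allFin n)))) ,
    λ v v∈ → subst (_∈ U) (lincomb-units v) (lincomb-∈ U v (tabulate unit) λ i →
      subst (λ u → lookup v i · u ∈ U) (sym (lookup∘tabulate unit i)) (scaled-unit v v∈ i))
    where
    U = span (Vec.fromList (List.map unit (List.filter (Subset._∈? S) (List.allFin n))))

    scaled-unit : ∀ v → v ∈ coordinateSpace S → ∀ i → lookup v i · unit i ∈ U
    scaled-unit v v∈ i with lookup S i in eq
    ... | inside  = ·-closed U (lookup v i) (span-∋ (List.∈-map⁺ unit
                      (List.∈-filter⁺ (Subset._∈? S) (List.∈-allFin i) (lookup⇒[]= i S eq))))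
    ... | outside = subst (λ c → c · unit i ∈ U) (sym (v∈ i eq))
                      (subst (_∈ U) (sym (·-zeroˡ (unit i))) (0-closed U))

  coordinateSpace-++ : (S : Subset n₁) (T : Subset n₂) →
                       coordinateSpace S ⊕ coordinateSpace T ≐ coordinateSpace (S ++ T)
  coordinateSpace-++ {n₁} S T = forth , back
    where
    lookup-take : (v : Vector (n₁ + n₂)) (i : Fin n₁) → lookup (take n₁ v) i ≡ lookup v (i ↑ˡ n₂)
    lookup-take v i = trans (sym (lookup-++ˡ (take n₁ v) (drop n₁ v) i))
      (cong (λ v → lookup v (i ↑ˡ _)) (take++drop≡id n₁ v))

    lookup-drop : (v : Vector (n₁ + n₂)) (i : Fin n₂) → lookup (drop n₁ v) i ≡ lookup v (n₁ ↑ʳ i)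
    lookup-drop v i = trans (sym (lookup-++ʳ (take n₁ v) (drop n₁ v) i))
      (cong (λ v → lookup v (n₁ ↑ʳ i)) (take++drop≡id n₁ v))

    forth : coordinateSpace S ⊕ coordinateSpace T ⊑ coordinateSpace (S ++ T)
    forth v (v₁∈ , v₂∈) i i∉ with splitAt n₁ i in eq
    ... | inj₁ j with refl ← Fin.splitAt⁻¹-↑ˡ {n₁} eq =
      trans (sym (lookup-take v j)) (v₁∈ j (trans (sym (lookup-++ˡ S T j)) i∉))
    ... | inj₂ j with refl ← Fin.splitAt⁻¹-↑ʳ {n₁} eq =
      trans (sym (lookup-drop v j)) (v₂∈ j (trans (sym (lookup-++ʳ S T j)) i∉))

    back : coordinateSpace (S ++ T) ⊑ (coordinateSpace S ⊕ coordinateSpace T)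
    back v v∈ =
      (λ i i∉S → trans (lookup-take v i) (v∈ (i ↑ˡ _) (trans (lookup-++ˡ S T i) i∉S))) ,
      (λ i i∉T → trans (lookup-drop v i) (v∈ (n₁ ↑ʳ i) (trans (lookup-++ʳ S T i) i∉T)))

  ⊕-isCoordinate : {X : Subspace n₁} {Y : Subspace n₂} → IsCoordinate X → IsCoordinate Y →
                   IsCoordinate (X ⊕ Y)
  ⊕-isCoordinate (S , X⊑ , ⊑X) (T , Y⊑ , ⊑Y) = S ++ T ,
    (λ v (v₁∈X , v₂∈Y) → proj₂ (span-units (S ++ T)) v (proj₁ (coordinateSpace-++ S T) v
      (proj₁ (span-units S) _ (X⊑ _ v₁∈X) , proj₁ (span-units T) _ (Y⊑ _ v₂∈Y)))) ,
    (λ v v∈ → let v₁∈ , v₂∈ = proj₂ (coordinateSpace-++ S T) v (proj₁ (span-units (S ++ T)) v v∈)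
              in ⊑X _ (proj₂ (span-units S) _ v₁∈) , ⊑Y _ (proj₂ (span-units T) _ v₂∈))

  ⊕ʳ-isCoordinate : {ρ₁ : RankFunction n₁} {ρ₂ : RankFunction n₂} →
    IsCoordinateQMatroid ρ₁ → IsCoordinateQMatroid ρ₂ → IsCoordinateQMatroid (ρ₁ ⊕ʳ ρ₂)
  ⊕ʳ-isCoordinate {n₁} coordinate₁ coordinate₂ = record
    { isQMatroid             = ⊕ʳ-isQMatroid M₁.isQMatroid M₂.isQMatroid
    ; cyclicFlats-coordinate = λ X cyclicFlat →
        let X⊑⊕ , ⊕⊑X = cyclicFlat-⊕ M₁.isQMatroid M₂.isQMatroid X cyclicFlat
            S , ⊕⊑S , S⊑⊕ = ⊕-isCoordinate {X = π₁ n₁ X} {π₂ n₁ X}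
              (M₁.cyclicFlats-coordinate _ (cyclicFlat-π₁ M₁.isQMatroid M₂.isQMatroid X cyclicFlat))
              (M₂.cyclicFlats-coordinate _ (cyclicFlat-π₂ M₁.isQMatroid M₂.isQMatroid X cyclicFlat))
        in S , (λ v → ⊕⊑S v ∘ X⊑⊕ v) , (λ v → ⊕⊑X v ∘ S⊑⊕ v)
    }
    where
    module M₁ = IsCoordinateQMatroid coordinate₁
    module M₂ = IsCoordinateQMatroid coordinate₂

theorem4p7 : ∀ {q : ℕ} → IsPrimePower q → (F : FiniteField q) → let open QMatroids F in
    ∀ {n₁ n₂ k ℓ : ℕ} (ρ₁ : RankFunction n₁) (ρ₂ : RankFunction n₂)
    (𝒳₁ : Vec (Subspace n₁) k) (𝒳₂ : Vec (Subspace n₂) ℓ) →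
    IsTransversalQMatroid ρ₁ 𝒳₁ → IsTransversalQMatroid ρ₂ 𝒳₂ →
    IsCoordinateQMatroid ρ₁ → IsCoordinateQMatroid ρ₂ →
    IsCoordinateQMatroid (ρ₁ ⊕ʳ ρ₂) × IsTransversalQMatroid (ρ₁ ⊕ʳ ρ₂) (𝒳₁ ⊕ᵖ 𝒳₂)
theorem4p7 _ F ρ₁ ρ₂ 𝒳₁ 𝒳₂ transversal₁ transversal₂ coordinate₁ coordinate₂ =
  ⊕ʳ-isCoordinate F coordinate₁ coordinate₂ , ⊕ʳ-isTransversal F transversal₁ transversal₂
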